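{- On metric graphs the skeleton dimension and the treewidth are incomparable, i.e. on the class of metric weighted graphs neither parameter is bounded by a function of the other.
   Context: Graphs $G=(V,E)$ are finite, simple, undirected and connected, with edge weights $\ell\colon E\to\mathbb{Q}^+$; $\mathrm{dist}_G(u,v)$ is the shortest path distance, and the shortest path between any two nodes is assumed to be unique. A weighted graph is metric if its edge weights satisfy the triangle inequality, i.e. $\ell(\{u,v\})=\mathrm{dist}_G(u,v)$ for every edge $\{u,v\}\in E$. Parameters $p,q$ are incomparable on a class of graphs if there is no function $f\colon\mathbb{N}\to\mathbb{N}$ with $p(G)\le f(q(G))$ for all $G$ in the class and no function $g\colon\mathbb{N}\to\mathbb{N}$ with $q(G)\le g(p(G))$ for all $G$ in the class. Treewidth (defined in the standard way) is applied to weighted graphs by ignoring the weights. Geometric realization: $\tilde G=(\tilde V,\tilde E)$ is the continuous version of $G$ in which every edge $\{u,v\}$ is replaced by a segment of length $\ell(\{u,v\})$; thus $V\subseteq\tilde V$, distances between nodes of $V$ are unchanged, and for every edge $\{u,v\}$ and $0\le\alpha\le\ell(\{u,v\})$ there is a point $w\in\tilde V$ on it with $\mathrm{dist}(u,w)=\alpha$ and $\mathrm{dist}(w,v)=\ell(\{u,v\})-\alpha$. Skeleton dimension: for $s\in V$ let $T_s$ be the shortest path tree of $s$ and $\tilde T_s$ its geometric realization. The skeleton $T_s^*$ is the subtree of $\tilde T_s$ induced by all points $v$ that have a descendant $w$ in $\tilde T_s$ (rooted at $s$) with $\mathrm{dist}(v,w)\ge\frac12\mathrm{dist}(s,v)$.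 For $r\ge 0$, $\mathrm{Cut}_s^r$ is the set of all points $u$ of $T_s^*$ with $\mathrm{dist}(s,u)=r$. The skeleton dimension of $G$ is $\kappa=\max_{s,r}|\mathrm{Cut}_s^r|$. -}

module Defs where

open import Level using (_⊔_; 0ℓ)
open import Data.Fin using (Fin)
open import Data.List using (List; []; _∷_; length)
open import Data.List.Membership.Propositional using (_∈_)
open import Data.List.Relation.Unary.Unique.Propositional using (Unique)
open import Data.Nat as ℕ using (ℕ; suc)
open import Data.Product using (Σ; ∃-syntax; _×_)
open import Data.Rational using (ℚ; 0ℚ; ½; _+_; _-_; _*_; _≤_; _<_; ∣_∣)
open import Function.Bundles using (_↔_; _⇔_)
open import Relation.Binary.Construct.Closure.ReflexiveTransitive using (Star; ε; _◅_; _◅◅_)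
open import Relation.Binary.Core using (Rel)
open import Relation.Binary.Definitions using (Decidable; Symmetric)
open import Relation.Binary.PropositionalEquality using (_≡_)
open import Relation.Nullary using (¬_)

IsMaximum : ∀ {a} → (ℕ → Set a) → ℕ → Set a
IsMaximum P m = P m × (∀ k → P k → k ℕ.≤ m)

IsMinimum : ∀ {a} → (ℕ → Set a) → ℕ → Set a
IsMinimum P m = P m × (∀ k → P k → m ℕ.≤ k)

HasCardinality : {A : Set} → (A → Set) → ℕ → Set
HasCardinality {A} P m =
  ∃[ xs ] Unique xs × (∀ (x : A) → x ∈ xs ⇔ P x) × length xs ≡ m

-- A walk is an element of Star _~_.  Repeated vertices are allowed; since
-- edge weights are positive, shortest walks are shortest paths.

vertices : {V : Set} {_~_ : Rel V 0ℓ} {u v : V} → Star _~_ u v → List V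
vertices {u = u} ε       = u ∷ []
vertices {u = u} (_ ◅ p) = u ∷ vertices p

module Distance {V : Set} (_~_ : Rel V 0ℓ) (weight : ∀ {u v} → u ~ v → ℚ) where

  walkLength : ∀ {u v} → Star _~_ u v → ℚ
  walkLength ε       = 0ℚ
  walkLength (e ◅ p) = weight e + walkLength p

  IsShortest : ∀ {u v} → Star _~_ u v → Set
  IsShortest {u} {v} p = ∀ (q : Star _~_ u v) → walkLength p ≤ walkLength q

  HasDistance : V → V → ℚ → Set
  HasDistance u v d = ∃[ p ] IsShortest {u} {v} p × walkLength p ≡ d

record SimpleGraph : Set₁ where
  infix 4 _~_
  field
    Vertex   : Set
    order    : ℕ
    finite   : Vertex ↔ Fin order
    _~_      : Rel Vertex 0ℓ
    _~?_     : Decidable _~_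
    ~-sym    : Symmetric _~_
    ~-irrefl : ∀ v → ¬ (v ~ v)

-- The graph without vertices does not count as connected.
IsConnected : SimpleGraph → Set
IsConnected G = Vertex × (∀ u v → Star _~_ u v)
  where open SimpleGraph G

-- A cycle is given as a path on at least three vertices together with an
-- edge joining its ends.
IsAcyclic : SimpleGraph → Set
IsAcyclic G = ∀ {u v} (p : Star _~_ u v) →
  Unique (vertices p) → 3 ℕ.≤ length (vertices p) → ¬ (v ~ u)
  where open SimpleGraph G

IsTree : SimpleGraph → Set
IsTree G = IsConnected G × IsAcyclic G

-- ℓ u v is only meaningful when u ~ v.
record WeightedGraph : Set₁ where
  field
    graph     : SimpleGraph
  open SimpleGraph graph public
  field
    connected : IsConnected graph
    ℓ         : Vertex → Vertex → ℚ
    ℓ-sym     : ∀ {u v} → u ~ v → ℓ u v ≡ ℓ v u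
    ℓ-pos     : ∀ {u v} → u ~ v → 0ℚ < ℓ u v
  open Distance _~_ (λ {u} {v} _ → ℓ u v) public
  field
    unique-shortest : ∀ {u v} (p q : Star _~_ u v) →
      IsShortest p → IsShortest q → vertices p ≡ vertices q

IsMetric : WeightedGraph → Set
IsMetric G = ∀ {u v} → u ~ v → HasDistance u v (ℓ u v)
  where open WeightedGraph G

record TreeDecomposition (G : SimpleGraph) : Set₁ where
  open SimpleGraph G
  field
    tree   : SimpleGraph
    isTree : IsTree tree
  open SimpleGraph tree using () renaming (Vertex to Node; _~_ to _~ₜ_)
  field
    bag           : Node → List Vertex
    bag-unique    : ∀ t → Unique (bag t)
    covers-vertex : ∀ v → ∃[ t ] v ∈ bag t
    covers-edge   : ∀ {u v} → u ~ v → ∃[ t ] u ∈ bag t × v ∈ bag t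
    -- the nodes whose bags contain v induce a connected subgraph of the tree
    coherent      : ∀ v {t t′} → v ∈ bag t → v ∈ bag t′ →
      Star (λ a b → a ~ₜ b × v ∈ bag a × v ∈ bag b) t t′

-- width = (maximum size of a bag) - 1
HasWidth : ∀ {G} → TreeDecomposition G → ℕ → Set
HasWidth D w = IsMaximum (λ m → ∃[ t ] length (bag t) ≡ m) (suc w)
  where open TreeDecomposition D

HasTreewidth : SimpleGraph → ℕ → Set₁
HasTreewidth G = IsMinimum (λ w → Σ (TreeDecomposition G) (λ D → HasWidth D w))

-- The graph is given by a relation Arc listing each undirected edge in
-- exactly one of its two directions, so that every point has a unique name:
-- inner u v α is the point at distance α from u inside the edge from u to v.
-- The type Point also contains names of no point (no such arc, or α out of
-- range); these lie on no segment.  Offsets are rational: as edge lengths are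
-- rational, admitting irrational ones would not change the maximum size of a
-- cut in the skeleton dimension.

module Realization {V : Set} (Arc : Rel V 0ℓ) (ℓ : V → V → ℚ) where

  data Point : Set where
    node  : V → Point
    inner : V → V → ℚ → Point

  -- OnEdge u v α x: x is the point of the closed edge from u to v whose
  -- distance from u along that edge is α.
  data OnEdge (u v : V) : ℚ → Point → Set where
    tail    : OnEdge u v 0ℚ (node u)
    head    : OnEdge u v (ℓ u v) (node v)
    between : ∀ {α} → 0ℚ < α → α < ℓ u v → OnEdge u v α (inner u v α)

  record Segment (x y : Point) : Set where
    field
      {u v} : V
      arc   : Arc u v
      α β   : ℚ
      x-at  : OnEdge u v α x
      y-at  : OnEdge u v β y

  segmentLength : ∀ {x y} → Segment x y → ℚ
  segmentLength s = ∣ Segment.α s - Segment.β s ∣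

  open Distance Segment segmentLength public

  Along : ∀ {x y} → Segment x y → Set
  Along s = Segment.α s ≤ Segment.β s

module ShortestPathTree (G : WeightedGraph) (s : WeightedGraph.Vertex G) where
  open WeightedGraph G using (Vertex; _~_; ℓ; IsShortest)

  -- u is the parent of v: the shortest path from s to v ends with the edge
  -- from u to v.
  Parent : Rel Vertex 0ℓ
  Parent u v = Σ (Star _~_ s u) λ p → Σ (u ~ v) λ e → IsShortest (p ◅◅ (e ◅ ε))

  -- Arcs point from parent to child, i.e. away from the root s.
  open Realization Parent ℓ public

  -- Descendant x w: w is a descendant of x (each point being a descendant
  -- of itself).
  Descendant : Rel Point 0ℓ
  Descendant = Star (λ x y → Σ (Segment x y) Along)

  Skeleton : Point → Set
  Skeleton x = ∃[ w ] ∃[ a ] ∃[ b ]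
    Descendant x w × HasDistance (node s) x a × HasDistance x w b × ½ * a ≤ b

  Cut : ℚ → Point → Set
  Cut r x = Skeleton x × HasDistance (node s) x r

HasSkeletonDimension : WeightedGraph → ℕ → Set
HasSkeletonDimension G = IsMaximum λ m →
  ∃[ s ] ∃[ r ] 0ℚ ≤ r × HasCardinality (ShortestPathTree.Cut G s r) m

-- A parameter is a relation: p G k says that its value on G is k.

IsBoundedBy : ∀ {a b c} (C : WeightedGraph → Set a)
              (p : WeightedGraph → ℕ → Set b) (q : WeightedGraph → ℕ → Set c) →
              Set (Level.suc 0ℓ ⊔ a ⊔ b ⊔ c)
IsBoundedBy C p q =
  Σ (ℕ → ℕ) λ f → ∀ G → C G → ∀ k m → p G k → q G m → k ℕ.≤ f m

Incomparable : ∀ {a b c} (C : WeightedGraph → Set a)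
               (p : WeightedGraph → ℕ → Set b) (q : WeightedGraph → ℕ → Set c) →
               Set (Level.suc 0ℓ ⊔ a ⊔ b ⊔ c)
Incomparable C p q = ¬ IsBoundedBy C p q × ¬ IsBoundedBy C q p

-- A star has treewidth 1, but the cut around its centre at distance ½ meets
-- every leg, so the skeleton dimension is not bounded by the treewidth.
--
-- For the converse take a "skip list": level i is a path on the multiples of
-- 8^i below 8^n whose edges have length about 2^i, and each multiple of 8^(i+1)
-- on level i is joined to its copy on level i + 1.  The lower levels contain
-- arbitrarily large grids.  On the other hand higher levels are faster, so a
-- shortest path of length ≫ 2^i has to visit a level ≥ i, while only boundedly
-- many nodes of level ≥ i lie within distance O(2^i) of each other.  Applied to
-- the paths from a cut at radius r ≈ 2^i to descendants at distance ≥ r/2, this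
-- bounds the skeleton dimension by a constant.
--
-- Edge lengths are perturbed by distinct powers of two, relative to a large
-- scale, to make shortest paths unique.  Treewidth is bounded below by the
-- crosses of a grid: directing each node of a tree decomposition towards a cross
-- missed by its bag gives a walk without backtracking in a finite tree.

module Submission where

open import Defs
open import Data.Empty using (⊥)
open import Data.Fin as Fin using (Fin; zero; suc; toℕ; combine)
import Data.Fin.Properties as Fin
import Data.Integer as ℤ
import Data.Integer.Properties as ℤ
open import Data.List using (List; []; _∷_; _∷ʳ_; length; lookup; map; allFin)
open import Data.List.Membership.Propositional using (_∈_; _∉_; lose)
open import Data.List.Membership.Propositional.Properties using (∈-lookup; ∈-map⁺; ∈-map⁻; ∈-allFin)
open import Data.List.Properties using (length-map; length-tabulate; ∷ʳ-injectiveˡ; ∷ʳ-injectiveʳ)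
open import Data.List.Relation.Unary.All as All using (All; []; _∷_)
open import Data.List.Relation.Unary.All.Properties using (¬Any⇒All¬; All¬⇒¬Any)
open import Data.List.Relation.Unary.AllPairs using ([]; _∷_)
open import Data.List.Relation.Unary.Any as Any using (Any; here; there; any?)
open import Data.List.Relation.Unary.Any.Properties using (lookup-index)
open import Data.List.Relation.Unary.Unique.Propositional using (Unique)
import Data.List.Relation.Unary.Unique.Propositional.Properties as Unique
open import Data.Nat as ℕ using (ℕ; zero; suc; _+_; _*_; _∸_; _^_; _≤_; _<_; _⊓_; _⊔_; ∣_-_∣; z≤n; s≤s; _≤?_)
open import Data.Nat.DivMod using (_/_; _%_; _mod_; m≡m%n+[m/n]*n; m%n<n; [m+kn]%n≡m%n; m<n⇒m%n≡m)
open import Data.Nat.Properties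
open import Data.Nat.Tactic.RingSolver using (solve-∀)
open import Data.Product using (Σ; ∃-syntax; _×_; _,_; proj₁; proj₂)
open import Data.Rational as ℚ using (ℚ; 0ℚ; ½)
open import Data.Rational.Literals using (fromℤ)
import Data.Rational.Properties as ℚ
open import Data.Rational.Unnormalised using (*≡*)
import Data.Rational.Unnormalised.Properties as ℚᵘ
open import Data.Sum using (_⊎_; inj₁; inj₂; [_,_]′)
open import Data.Sum.Function.Propositional using (_⊎-↔_)
open import Data.Unit using (⊤; tt)
open import Function using (_∘_; id; flip)
open import Function.Bundles using (_↔_; Inverse; Injection; Equivalence; mk⇔; mk↔ₛ′)
open import Function.Construct.Composition using (_↔-∘_)
open import Function.Properties.Inverse using (↔⇒↣; ↔-refl; ↔-sym)
open import Level using (0ℓ)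
open import Relation.Binary.Construct.Closure.ReflexiveTransitive as Star using (Star; ε; _◅_; _◅◅_)
open import Relation.Binary.Construct.Closure.ReflexiveTransitive.Properties using (◅◅-assoc)
open import Relation.Binary.Core using (Rel)
open import Relation.Binary.Definitions using (DecidableEquality)
open import Relation.Binary.PropositionalEquality
open import Relation.Nullary using (¬_; Dec; yes; no; contradiction)
open import Relation.Nullary.Decidable using (_×-dec_; _⊎-dec_; ¬?; from-yes; map′; via-injection)
import Relation.Unary as U

-- Tree decompositions and grids

-- Two growth rates shape the skip list. Edge lengths grow by a factor of about 2 per level, which
-- keeps nodes of high level apart. Cells grow by a factor of 8, so a unit of length covers four
-- times as many positions one level up. Against the route through level i + 1, a walk below that
-- level pays, up to additive terms, at least 4 units of level i + 1 per cell, while the route pays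
-- at most 2, since a perturbation at most doubles an edge. The ratio 8 leaves room between these
-- two rates.
--
-- The points of a cut are not listed but coded in a fixed finite set. A code may name a vertex
-- below the point instead of the point itself, because in a tree two points of equal depth above a
-- common vertex coincide.
--
-- Values of the two parameters are never computed. They exist up to double negation, which is
-- enough because both claims are negations.

lookup-injective : {A : Set} {xs : List A} → Unique xs → ∀ {i j} → lookup xs i ≡ lookup xs j → i ≡ j
lookup-injective (_ ∷ _)  {zero}  {zero}  _  = refl
lookup-injective (x∉ ∷ _) {zero}  {suc j} eq = contradiction eq (All.lookup x∉ (∈-lookup j))
lookup-injective (x∉ ∷ _) {suc i} {zero}  eq = contradiction (sym eq) (All.lookup x∉ (∈-lookup i))
lookup-injective (_ ∷ u)  {suc i} {suc j} eq = cong suc (lookup-injective u eq)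

unique-length-≤ : {A : Set} {xs : List A} {m : ℕ} → Unique xs → (code : ∀ {x} → x ∈ xs → Fin m) →
  (∀ {x y} (p : x ∈ xs) (q : y ∈ xs) → code p ≡ code q → x ≡ y) → length xs ≤ m
unique-length-≤ u code code-injective = Fin.injective⇒≤ {f = λ i → code (∈-lookup i)}
  λ eq → lookup-injective u (code-injective _ _ eq)

vertices-map : {V : Set} {R S : Rel V 0ℓ} (f : ∀ {a b} → R a b → S a b) {a b : V} (p : Star R a b) →
  vertices (Star.map f p) ≡ vertices p
vertices-map f ε       = refl
vertices-map f (_ ◅ p) = cong (_ ∷_) (vertices-map f p)

suffix : {V : Set} {R : Rel V 0ℓ} {a b c : V} (p : Star R a b) → Unique (vertices p) → c ∈ vertices p →
  Σ (Star R c b) (Unique ∘ vertices)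
suffix ε       u       (here refl) = ε , u
suffix (e ◅ p) u       (here refl) = e ◅ p , u
suffix (_ ◅ p) (_ ∷ u) (there c∈)  = suffix p u c∈

prefix : {V : Set} {R : Rel V 0ℓ} {a b c : V} (p : Star R a b) → Unique (vertices p) → c ∈ vertices p →
  Σ (Star R a c) λ q → Unique (vertices q) × (∀ {x} → x ∈ vertices q → x ∈ vertices p)
prefix ε       u       (here refl) = ε , u , id
prefix (_ ◅ _) _       (here refl) = ε , [] ∷ [] , λ { (here eq) → here eq }
prefix (e ◅ p) (a∉ ∷ u) (there c∈) with prefix p u c∈
... | q , uq , sub = e ◅ q , All.tabulate (λ x∈ → All.lookup a∉ (sub x∈)) ∷ uq ,
  λ { (here eq) → here eq ; (there x∈) → there (sub x∈) }

simple-walk : {V : Set} {R : Rel V 0ℓ} → DecidableEquality V → {a b : V} → Star R a b →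
  Σ (Star R a b) (Unique ∘ vertices)
simple-walk _≟_ ε = ε , [] ∷ []
simple-walk _≟_ {a} (e ◅ p) with simple-walk _≟_ p
... | q , u with any? (a ≟_) (vertices q)
...   | yes a∈ = suffix q u a∈
...   | no  a∉ = e ◅ q , ¬Any⇒All¬ _ a∉ ∷ u

module FiniteGraph (G : SimpleGraph) where
  open SimpleGraph G

  vertex# : Vertex → Fin order
  vertex# = Inverse.to finite

  vertex#-injective : ∀ {u v} → vertex# u ≡ vertex# v → u ≡ v
  vertex#-injective = Injection.injective (↔⇒↣ finite)

  _≟ᵥ_ : DecidableEquality Vertex
  _≟ᵥ_ = via-injection (↔⇒↣ finite) Fin._≟_

  unique-bounded : ∀ {xs} → Unique xs → length xs ≤ order
  unique-bounded u = unique-length-≤ u (λ {x} _ → vertex# x) (λ _ _ → vertex#-injective)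

  -- Otherwise the iterates of next would form a path of unbounded length.
  backtracks : IsAcyclic G → Vertex → (next : Vertex → Vertex) → (∀ t → t ~ next t) →
    (∀ t → next (next t) ≢ t) → ⊥
  backtracks acyclic start next adj no-backtrack =
    1+n≰n (≤-trans (≤-reflexive (sym (proj₂ (trail order))))
                   (unique-bounded (simple (proj₂ (proj₁ (trail order))))))
    where
    -- New iterates are prepended, so a walk of `Back` runs from the latest iterate back to `start`.
    Back : Rel Vertex 0ℓ
    Back a b = a ≡ next b

    edge : ∀ {a b} → Back a b → a ~ b
    edge {b = b} refl = ~-sym (adj b)

    simple : ∀ {a} (p : Star Back a start) → Unique (vertices p)
    simple ε = [] ∷ []
    simple (_◅_ {a} {b} e p) = ¬Any⇒All¬ _ (λ a∈ → no-return (prefix p (simple p) a∈)) ∷ simple p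
      where
      no-return : ¬ (Σ (Star Back b a) λ q → Unique (vertices q) × (∀ {x} → x ∈ vertices q → x ∈ vertices p))
      -- A return to `a` closes a walk with one, two or more edges; these are excluded by
      -- irreflexivity, by `no-backtrack` and by acyclicity respectively.
      no-return (ε , _)              = ~-irrefl _ (edge e)
      no-return (e₁ ◅ ε , _)         = no-backtrack a (sym (trans e (cong next e₁)))
      no-return (q@(_ ◅ _ ◅ q′) , u , _) =
        acyclic (Star.map edge q) (subst Unique (sym (vertices-map edge q)) u) long (edge e)
        where
        long : 3 ≤ length (vertices (Star.map edge q))
        long = s≤s (s≤s (nonempty (Star.map edge q′)))
          where
          nonempty : ∀ {x y} (r : Star _~_ x y) → 1 ≤ length (vertices r)
          nonempty ε       = s≤s z≤n
          nonempty (_ ◅ _) = s≤s z≤n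

    trail : ∀ m → Σ (∃[ a ] Star Back a start) λ t → length (vertices (proj₂ t)) ≡ suc m
    trail zero = (start , ε) , refl
    trail (suc m) with trail m
    ... | (a , p) , eq = (next a , refl ◅ p) , cong suc eq

module Bramble {G : SimpleGraph} (D : TreeDecomposition G) where
  open SimpleGraph G
  open TreeDecomposition D
  open SimpleGraph tree using ()
    renaming (Vertex to Node; _~_ to _~ₜ_; ~-sym to ~ₜ-sym; ~-irrefl to ~ₜ-irrefl)
  open FiniteGraph tree using () renaming (_≟ᵥ_ to _≟ₜ_; backtracks to backtracksₜ)

  Avoiding : Node → Rel Node 0ℓ
  Avoiding t a b = a ~ₜ b × a ≢ t × b ≢ t

  -- Cut the walk after its last visit to `t`; if there is none, it avoids `t` altogether. The start
  -- `x` is arbitrary for the sake of the induction; in the application it is `t` itself, which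
  -- leaves the second alternative only.
  last-exit : ∀ t {x a} → Star _~ₜ_ x a → a ≢ t →
    (x ≢ t × Star (Avoiding t) x a) ⊎ (∃[ y ] t ~ₜ y × Star (Avoiding t) y a)
  last-exit t ε a≢t = inj₁ (a≢t , ε)
  last-exit t {x} (e ◅ p) a≢t with last-exit t p a≢t
  ... | inj₂ r = inj₂ r
  ... | inj₁ (y≢t , q) with x ≟ₜ t
  ...   | yes refl = inj₂ (_ , e , q)
  ...   | no x≢t   = inj₁ (x≢t , (e , x≢t , y≢t) ◅ q)

  -- The walks from t to c avoiding t′ and from c to t′ avoiding t close up to
  -- a cycle through the edge between t and t′.
  no-common-end : ∀ {t t′ c} → t ~ₜ t′ → Star (Avoiding t) t′ c → ¬ Star (Avoiding t′) t c
  no-common-end {t} {t′} {c} e p q = conclude (simple-walk _≟ₜ_ (Star.map left p ◅◅ Star.reverse flip-right q))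
    where
    -- Forbidding the step from `t′` to `t` rules out the walk consisting of that single edge, the
    -- one simple walk that acyclicity does not exclude.
    Other : Rel Node 0ℓ
    Other a b = a ~ₜ b × ¬ (a ≡ t′ × b ≡ t)

    left : ∀ {a b} → Avoiding t a b → Other a b
    left (a~b , _ , b≢t) = a~b , b≢t ∘ proj₂

    flip-right : ∀ {a b} → Avoiding t′ a b → Other b a
    flip-right (a~b , _ , b≢t′) = ~ₜ-sym a~b , b≢t′ ∘ proj₁

    conclude : ¬ Σ (Star Other t′ t) (Unique ∘ vertices)
    conclude (ε , _) = ~ₜ-irrefl _ e
    conclude ((_ , not-edge) ◅ ε , _) = not-edge (refl , refl)
    conclude (r@(_ ◅ _ ◅ r′) , u) =
      proj₂ isTree (Star.map proj₁ r) (subst Unique (sym (vertices-map proj₁ r)) u)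
        (s≤s (s≤s (nonempty (Star.map proj₁ r′)))) e
      where
      nonempty : ∀ {x y} (s : Star _~ₜ_ x y) → 1 ≤ length (vertices s)
      nonempty ε       = s≤s z≤n
      nonempty (_ ◅ _) = s≤s z≤n

  module _ {I : Set} (B : I → Vertex → Set)
    (connected : ∀ c {u v} → B c u → B c v → Star (λ a b → a ~ b × B c a × B c b) u v)
    (meet : ∀ c c′ → ∃[ v ] B c v × B c′ v) where

    -- A node missing a set is directed towards the bags which that set meets.
    some-bag-hits-all : ¬ (∀ t → Σ I λ c → ∀ v → B c v → v ∉ bag t)
    some-bag-hits-all miss =
      backtracksₜ (proj₂ isTree) (proj₁ (proj₁ isTree)) next (λ t → proj₁ (proj₂ (exit t))) no-backtrack
      where
      missed : Node → I
      missed t = proj₁ (miss t)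

      avoids : ∀ t {v x} → B (missed t) v → v ∈ bag x → x ≢ t
      avoids t b v∈ refl = proj₂ (miss t) _ b v∈

      home : ∀ t → ∃[ v ] B (missed t) v
      home t = let v , b , _ = meet (missed t) (missed t) in v , b

      home-node : Node → Node
      home-node t = proj₁ (covers-vertex (proj₁ (home t)))

      exit : ∀ t → ∃[ y ] t ~ₜ y × Star (Avoiding t) y (home-node t)
      exit t with last-exit t (proj₂ (proj₁ isTree) t (home-node t))
                    (avoids t (proj₂ (home t)) (proj₂ (covers-vertex (proj₁ (home t)))))
      ... | inj₁ (t≢t , _) = contradiction refl t≢t
      ... | inj₂ r = r

      next : Node → Node
      next t = proj₁ (exit t)

      -- A walk inside the missed set lifts to the tree: coherence moves between bags sharing a
      -- vertex, and `covers-edge` supplies a common bag for each step. Every bag on the way meets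
      -- the set, so none of them belongs to `t`.
      link : ∀ t {u v x y} → Star (λ a b → a ~ b × B (missed t) a × B (missed t) b) u v →
        B (missed t) u → u ∈ bag x → v ∈ bag y → Star (Avoiding t) x y
      link t ε b u∈ v∈ = Star.map (λ (e , p , q) → e , avoids t b p , avoids t b q) (coherent _ u∈ v∈)
      link t ((e , b , b′) ◅ p) _ u∈ v∈ with covers-edge e
      ... | z , u∈z , w∈z = link t ε b u∈ u∈z ◅◅ link t p b′ w∈z v∈

      reach : ∀ t {v y} → B (missed t) v → v ∈ bag y → Star (Avoiding t) (next t) y
      reach t b v∈ = proj₂ (proj₂ (exit t)) ◅◅
        link t (connected _ (proj₂ (home t)) b) (proj₂ (home t)) (proj₂ (covers-vertex (proj₁ (home t)))) v∈

      -- The sets missed at `t` and at `next t` share a vertex. A bag containing it can be reached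
      -- from `next t` avoiding `t`, and, if the direction turned back, also from `t` avoiding
      -- `next t`.
      no-backtrack : ∀ t → next (next t) ≢ t
      no-backtrack t eq with meet (missed t) (missed (next t))
      ... | v , b , b′ with covers-vertex v
      ...   | c , v∈ = no-common-end (proj₁ (proj₂ (exit t))) (reach t b v∈)
                         (subst (λ z → Star (Avoiding (next t)) z c) eq (reach (next t) b′ v∈))

module Grid (G : SimpleGraph) {K : ℕ} (Row Col : Fin K → SimpleGraph.Vertex G → Set)
  (Row? : ∀ i → U.Decidable (Row i)) (Col? : ∀ i → U.Decidable (Col i))
  (row-disjoint : ∀ {i j v} → Row i v → Row j v → i ≡ j)
  (col-disjoint : ∀ {i j v} → Col i v → Col j v → i ≡ j)
  (row-connected : ∀ i {u v} → Row i u → Row i v → 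
    Star (λ a b → SimpleGraph._~_ G a b × Row i a × Row i b) u v)
  (col-connected : ∀ i {u v} → Col i u → Col i v → 
    Star (λ a b → SimpleGraph._~_ G a b × Col i a × Col i b) u v)
  (crossing : ∀ i j → ∃[ v ] Row i v × Col j v) where

  open SimpleGraph G

  -- Pigeonhole: disjoint lines are hit at different entries of `vs`.
  some-missed : (Line : Fin K → Vertex → Set) → (∀ i → U.Decidable (Line i)) →
    (∀ {i j v} → Line i v → Line j v → i ≡ j) →
    ∀ vs → length vs < K → ∃[ i ] ∀ v → Line i v → v ∉ vs
  some-missed Line Line? disjoint vs short with Fin.¬∀⟶∃¬ K _ (λ i → any? (Line? i) vs) ¬all-hit
    where
    ¬all-hit : ¬ (∀ i → Any (Line i) vs)
    ¬all-hit hit = <⇒≱ short (Fin.injective⇒≤ {f = λ i → Any.index (hit i)} λ {i} {j} eq →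
      disjoint (lookup-index (hit i))
        (subst (λ k → Line j (lookup vs k)) (sym eq) (lookup-index (hit j))))
  ... | i , missed = i , λ v l v∈ → missed (lose v∈ l)

  -- Two crosses meet where the row of one crosses the column of the other. A bag with fewer than
  -- `K` vertices misses a whole row and a whole column, hence a cross.
  bag-large : (D : TreeDecomposition G) → ∀ {w} → HasWidth D w → K ≤ suc w
  bag-large D {w} (_ , maximal) = ≮⇒≥ λ small →
    Bramble.some-bag-hits-all D Cross cross-connected
      (λ (i , j) (i′ , j′) → let v , r , c = crossing i j′ in v , inj₁ r , inj₂ c)
      λ t → let short = ≤-<-trans (maximal _ (t , refl)) small
                i , row-missed = some-missed Row Row? row-disjoint (TreeDecomposition.bag D t) short
                j , col-missed = some-missed Col Col? col-disjoint (TreeDecomposition.bag D t) short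
            in (i , j) , λ v → [ row-missed v , col-missed v ]′
    where
    Cross : Fin K × Fin K → Vertex → Set
    Cross (i , j) v = Row i v ⊎ Col j v

    in-row : ∀ {i j u v} → Row i u → Row i v →
      Star (λ a b → a ~ b × Cross (i , j) a × Cross (i , j) b) u v
    in-row r r′ = Star.map (λ (e , p , q) → e , inj₁ p , inj₁ q) (row-connected _ r r′)

    in-col : ∀ {i j u v} → Col j u → Col j v →
      Star (λ a b → a ~ b × Cross (i , j) a × Cross (i , j) b) u v
    in-col c c′ = Star.map (λ (e , p , q) → e , inj₂ p , inj₂ q) (col-connected _ c c′)

    cross-connected : ∀ c {u v} → Cross c u → Cross c v → Star (λ a b → a ~ b × Cross c a × Cross c b) u v
    cross-connected (i , j) p q with crossing i j
    ... | x , r , c = to-centre p ◅◅ from-centre q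
      where
      to-centre : ∀ {u} → Cross (i , j) u → Star (λ a b → a ~ b × Cross (i , j) a × Cross (i , j) b) u x
      to-centre (inj₁ r′) = in-row r′ r
      to-centre (inj₂ c′) = in-col c′ c

      from-centre : ∀ {u} → Cross (i , j) u → Star (λ a b → a ~ b × Cross (i , j) a × Cross (i , j) b) x u
      from-centre (inj₁ r′) = in-row r r′
      from-centre (inj₂ c′) = in-col c c′

-- Unique shortest paths by perturbation

opaque
  fromℕ : ℕ → ℚ
  fromℕ n = fromℤ (ℤ.+ n)

  fromℕ-+ : ∀ m n → fromℕ (m + n) ≡ fromℕ m ℚ.+ fromℕ n
  fromℕ-+ m n = ℚ.toℚᵘ-injective (ℚᵘ.≃-sym (ℚᵘ.≃-trans (ℚ.toℚᵘ-homo-+ (fromℕ m) (fromℕ n))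
    (*≡* (cong (ℤ._* ℤ.1ℤ) (cong₂ ℤ._+_ (ℤ.*-identityʳ (ℤ.+ m)) (ℤ.*-identityʳ (ℤ.+ n)))))))

  fromℕ-mono-≤ : ∀ {m n} → m ≤ n → fromℕ m ℚ.≤ fromℕ n
  fromℕ-mono-≤ m≤n = ℚ.*≤* (ℤ.*-monoʳ-≤-nonNeg ℤ.1ℤ (ℤ.+≤+ m≤n))

  fromℕ-cancel-≤ : ∀ {m n} → fromℕ m ℚ.≤ fromℕ n → m ≤ n
  fromℕ-cancel-≤ {m} {n} (ℚ.*≤* le) = ℤ.drop‿+≤+ (ℤ.*-cancelʳ-≤-pos (ℤ.+ m) (ℤ.+ n) ℤ.1ℤ le)

  fromℕ-mono-< : ∀ {m n} → m < n → fromℕ m ℚ.< fromℕ n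
  fromℕ-mono-< m<n = ℚ.*<* (ℤ.*-monoʳ-<-pos ℤ.1ℤ (ℤ.+<+ m<n))

  ≤-fromℕ : ∀ p → ∃[ n ] p ℚ.≤ fromℕ n
  ≤-fromℕ (ℚ.mkℚ (ℤ.+ n) d _)      = n , ℚ.*≤* (ℤ.*-monoˡ-≤-nonNeg (ℤ.+ n) (ℤ.+≤+ (s≤s z≤n)))
  ≤-fromℕ (ℚ.mkℚ (ℤ.-[1+ n ]) d _) = 0 , ℚ.*≤* ℤ.-≤+

  fromℕ-0 : fromℕ 0 ≡ 0ℚ
  fromℕ-0 = refl

  fromℕ-1 : fromℕ 1 ≡ ℚ.1ℚ
  fromℕ-1 = refl

fromℕ-nonneg : ∀ n → 0ℚ ℚ.≤ fromℕ n
fromℕ-nonneg n = subst (ℚ._≤ fromℕ n) fromℕ-0 (fromℕ-mono-≤ {0} {n} z≤n)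

fromℕ-pos : ∀ {n} → 0 < n → 0ℚ ℚ.< fromℕ n
fromℕ-pos {n} 0<n = subst (ℚ._< fromℕ n) fromℕ-0 (fromℕ-mono-< 0<n)

fromℕ-≥1 : ∀ {n} → 0 < n → ℚ.1ℚ ℚ.≤ fromℕ n
fromℕ-≥1 {n} 0<n = subst (ℚ._≤ fromℕ n) fromℕ-1 (fromℕ-mono-≤ 0<n)

-- The sum of `c i` times 2^i over i below `n`. It is a genuine binary numeral only when every `c i`
-- is at most 1, but its additivity holds for all `c`.
binary : ℕ → (ℕ → ℕ) → ℕ
binary zero    c = 0
binary (suc n) c = c 0 + 2 * binary n (c ∘ suc)

δ : ℕ → ℕ → ℕ
δ zero    zero    = 1
δ zero    (suc _) = 0
δ (suc _) zero    = 0
δ (suc m) (suc n) = δ m n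

δ-refl : ∀ n → δ n n ≡ 1
δ-refl zero    = refl
δ-refl (suc n) = δ-refl n

δ-≢ : ∀ {m n} → m ≢ n → δ m n ≡ 0
δ-≢ {zero}  {zero}  ne = contradiction refl ne
δ-≢ {zero}  {suc n} ne = refl
δ-≢ {suc m} {zero}  ne = refl
δ-≢ {suc m} {suc n} ne = δ-≢ (ne ∘ cong suc)

binary-0 : ∀ n → binary n (λ _ → 0) ≡ 0
binary-0 zero    = refl
binary-0 (suc n) = cong (2 *_) (binary-0 n)

binary-+ : ∀ n c d → binary n (λ i → c i + d i) ≡ binary n c + binary n d
binary-+ zero    c d = refl
binary-+ (suc n) c d rewrite binary-+ n (c ∘ suc) (d ∘ suc) =
  shuffle (c 0) (d 0) (binary n (c ∘ suc)) (binary n (d ∘ suc))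
  where
  shuffle : ∀ a b x y → a + b + 2 * (x + y) ≡ a + 2 * x + (b + 2 * y)
  shuffle = solve-∀

binary-δ : ∀ {n k} → k < n → binary n (δ k) ≡ 2 ^ k
binary-δ {suc n} {zero}  _         = cong (λ z → 1 + 2 * z) (binary-0 n)
binary-δ {suc n} {suc k} (s≤s k<n) = cong (2 *_) (binary-δ k<n)

binary-< : ∀ n c → (∀ i → c i ≤ 1) → binary n c < 2 ^ n
binary-< zero    c c≤1 = s≤s z≤n
binary-< (suc n) c c≤1 = begin-strict
  c 0 + 2 * binary n (c ∘ suc)     <⟨ s≤s (+-monoˡ-≤ _ (c≤1 0)) ⟩
  2 + 2 * binary n (c ∘ suc)       ≡⟨ sym (*-suc 2 (binary n (c ∘ suc))) ⟩
  2 * suc (binary n (c ∘ suc))     ≤⟨ *-monoʳ-≤ 2 (binary-< n (c ∘ suc) (c≤1 ∘ suc)) ⟩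
  2 ^ suc n ∎
  where open ≤-Reasoning

digit-unique : ∀ {a b} x y → a ≤ 1 → b ≤ 1 → a + 2 * x ≡ b + 2 * y → a ≡ b × x ≡ y
digit-unique x y z≤n       z≤n       eq = refl , *-cancelˡ-≡ x y 2 eq
digit-unique x y z≤n       (s≤s z≤n) eq = contradiction eq (even≢odd x y)
digit-unique x y (s≤s z≤n) z≤n       eq = contradiction (sym eq) (even≢odd y x)
digit-unique x y (s≤s z≤n) (s≤s z≤n) eq = refl , *-cancelˡ-≡ x y 2 (suc-injective eq)

binary-injective : ∀ n c d → (∀ i → c i ≤ 1) → (∀ i → d i ≤ 1) → binary n c ≡ binary n d →
  ∀ {i} → i < n → c i ≡ d i
binary-injective (suc n) c d c≤1 d≤1 eq {i} i<n 
  with digit-unique (binary n (c ∘ suc)) (binary n (d ∘ suc)) (c≤1 0) (d≤1 0) eq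
binary-injective (suc n) c d c≤1 d≤1 eq {zero}  _         | c₀≡d₀ , _ = c₀≡d₀
binary-injective (suc n) c d c≤1 d≤1 eq {suc i} (s≤s i<n) | _ , eq′ =
  binary-injective n (c ∘ suc) (d ∘ suc) (c≤1 ∘ suc) (d≤1 ∘ suc) eq′ i<n

start∈ : {V : Set} {R : V → V → Set} {u v : V} (p : Star R u v) → u ∈ vertices p
start∈ ε       = here refl
start∈ (_ ◅ _) = here refl

end∈ : {V : Set} {R : V → V → Set} {u v : V} (p : Star R u v) → v ∈ vertices p
end∈ ε       = here refl
end∈ (_ ◅ p) = there (end∈ p)

-- Adding a distinct power of two to each edge of a graph with large weights
-- makes shortest paths unique: the perturbation of a path determines its edges.
module Perturbed (G : SimpleGraph) (connected : IsConnected G)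
  (base : SimpleGraph.Vertex G → SimpleGraph.Vertex G → ℕ)
  (base-sym : ∀ u v → base u v ≡ base v u) where

  open SimpleGraph G
  open FiniteGraph G public

  Walk : Vertex → Vertex → Set
  Walk = Star _~_

  -- The ends are sorted first, so that both directions of an edge receive the same power of two.
  edge# : Vertex → Vertex → Fin (order * order)
  edge# u v with toℕ (vertex# u) ≤? toℕ (vertex# v)
  ... | yes _ = combine (vertex# u) (vertex# v)
  ... | no  _ = combine (vertex# v) (vertex# u)

  edge#-sym : ∀ u v → edge# u v ≡ edge# v u
  edge#-sym u v with toℕ (vertex# u) ≤? toℕ (vertex# v) | toℕ (vertex# v) ≤? toℕ (vertex# u)
  ... | yes u≤v | yes v≤u = let eq = Fin.toℕ-injective (≤-antisym u≤v v≤u) in cong₂ combine eq (sym eq)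
  ... | yes _   | no _    = refl
  ... | no _    | yes _   = refl
  ... | no u≰v  | no v≰u  = contradiction (≰⇒≥ u≰v) v≰u

  combine⁻¹ : ∀ {u v u′ v′} → combine (vertex# u) (vertex# v) ≡ combine (vertex# u′) (vertex# v′) →
    u ≡ u′ × v ≡ v′
  combine⁻¹ {u} {v} {u′} {v′} eq with Fin.combine-injective (vertex# u) (vertex# v) _ _ eq
  ... | p , q = vertex#-injective p , vertex#-injective q

  edge#-injective : ∀ u v u′ v′ → edge# u v ≡ edge# u′ v′ → (u ≡ u′ × v ≡ v′) ⊎ (u ≡ v′ × v ≡ u′)
  edge#-injective u v u′ v′ eq
    with toℕ (vertex# u) ≤? toℕ (vertex# v) | toℕ (vertex# u′) ≤? toℕ (vertex# v′)
  ... | yes _ | yes _ = inj₁ (combine⁻¹ eq)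
  ... | yes _ | no _  = inj₂ (combine⁻¹ eq)
  ... | no _  | yes _ = inj₂ (let p , q = combine⁻¹ eq in q , p)
  ... | no _  | no _  = inj₁ (let p , q = combine⁻¹ eq in q , p)

  edge#ℕ : Vertex → Vertex → ℕ
  edge#ℕ u v = toℕ (edge# u v)

  -- More than any sum of distinct perturbations, so the perturbation of a simple walk is its length
  -- modulo `scale`.
  scale : ℕ
  scale = 2 ^ (order * order)

  instance
    scale-nonZero : ℕ.NonZero scale
    scale-nonZero = m^n≢0 2 (order * order)

  weight : Vertex → Vertex → ℕ
  weight u v = base u v * scale + 2 ^ edge#ℕ u v

  weight-sym : ∀ u v → weight u v ≡ weight v u
  weight-sym u v = cong₂ (λ b e → b * scale + 2 ^ toℕ e) (base-sym u v) (edge#-sym u v)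

  weight-≥ : ∀ u v → base u v * scale ≤ weight u v
  weight-≥ u v = m≤m+n _ _

  weight-≤ : ∀ u v → weight u v ≤ base u v * scale + scale
  weight-≤ u v = +-monoʳ-≤ _ (^-monoʳ-≤ 2 (<⇒≤ (Fin.toℕ<n (edge# u v))))

  weight-pos : ∀ u v → 0 < weight u v
  weight-pos u v = ≤-trans (m^n>0 2 (edge#ℕ u v)) (m≤n+m _ _)

  len : ∀ {u v} → Walk u v → ℕ
  len ε                   = 0
  len (_◅_ {u} {v} _ p) = weight u v + len p

  len-◅◅ : ∀ {u v w} (p : Walk u v) (q : Walk v w) → len (p ◅◅ q) ≡ len p + len q
  len-◅◅ ε       q = refl
  len-◅◅ (e ◅ p) q = trans (cong (weight _ _ +_) (len-◅◅ p q)) (sym (+-assoc (weight _ _) (len p) (len q)))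

  reverse : ∀ {u v} → Walk u v → Walk v u
  reverse ε       = ε
  reverse (e ◅ p) = reverse p ◅◅ (~-sym e ◅ ε)

  len-reverse : ∀ {u v} (p : Walk u v) → len (reverse p) ≡ len p
  len-reverse ε = refl
  len-reverse (_◅_ {u} {v} e p) = begin
    len (reverse p ◅◅ (~-sym e ◅ ε))  ≡⟨ len-◅◅ (reverse p) (~-sym e ◅ ε) ⟩
    len (reverse p) + (weight v u + 0) ≡⟨ cong₂ _+_ (len-reverse p) (+-identityʳ _) ⟩
    len p + weight v u                 ≡⟨ +-comm (len p) _ ⟩
    weight v u + len p                 ≡⟨ cong (_+ len p) (weight-sym v u) ⟩
    weight u v + len p ∎
    where open ≡-Reasoning

  Shortest : ∀ {u v} → Walk u v → Set
  Shortest {u} {v} p = ∀ (q : Walk u v) → len p ≤ len q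

  tail-shortest : ∀ {u v w} (e : u ~ v) (p : Walk v w) → Shortest (e ◅ p) → Shortest p
  tail-shortest e p s q = +-cancelˡ-≤ (weight _ _) _ _ (s (e ◅ q))

  suffix-shorter : ∀ {u v c} (p : Walk u v) → c ∈ vertices p → Σ (Walk c v) λ q → len q ≤ len p
  suffix-shorter ε       (here refl) = ε , ≤-refl
  suffix-shorter (e ◅ p) (here refl) = e ◅ p , ≤-refl
  suffix-shorter (_ ◅ p) (there c∈)  with suffix-shorter p c∈
  ... | q , q≤p = q , ≤-trans q≤p (m≤n+m _ _)

  -- Cutting out a loop would strictly shorten the walk. Simplicity ensures that each edge is used
  -- at most once, so that the counts are binary digits.
  shortest-unique : ∀ {u v} (p : Walk u v) → Shortest p → Unique (vertices p)
  shortest-unique ε       s = [] ∷ []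
  shortest-unique (_◅_ {u} {v} e p) s = ¬Any⇒All¬ _ no-return ∷ shortest-unique p (tail-shortest e p s)
    where
    no-return : u ∉ vertices p
    no-return u∈ with suffix-shorter p u∈
    ... | q , q≤p = <⇒≱ (m<n+m (len p) (weight-pos u v)) (≤-trans (s q) q≤p)

  count : ∀ {u v} → Walk u v → ℕ → ℕ
  count ε                 i = 0
  count (_◅_ {u} {v} _ p) i = δ (edge#ℕ u v) i + count p i

  base-len : ∀ {u v} → Walk u v → ℕ
  base-len ε                 = 0
  base-len (_◅_ {u} {v} _ p) = base u v + base-len p

  len-binary : ∀ {u v} (p : Walk u v) → len p ≡ binary (order * order) (count p) + base-len p * scale
  len-binary ε = sym (trans (+-identityʳ _) (binary-0 (order * order)))
  len-binary (_◅_ {u} {v} e p) = begin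
    base u v * scale + 2 ^ edge#ℕ u v + len p
      ≡⟨ cong₂ (λ x y → base u v * scale + x + y) (sym (binary-δ (Fin.toℕ<n (edge# u v)))) (len-binary p) ⟩
    base u v * scale + x + (y + base-len p * scale)
      ≡⟨ shuffle (base u v) scale x y (base-len p) ⟩
    x + y + (base u v + base-len p) * scale
      ≡⟨ cong (_+ (base u v + base-len p) * scale) (sym (binary-+ (order * order) (δ (edge#ℕ u v)) (count p))) ⟩
    binary (order * order) (count (e ◅ p)) + (base u v + base-len p) * scale ∎
    where
    open ≡-Reasoning
    x y : ℕ
    x = binary (order * order) (δ (edge#ℕ u v))
    y = binary (order * order) (count p)
    shuffle : ∀ b s x y l → b * s + x + (y + l * s) ≡ x + y + (b + l) * s
    shuffle = solve-∀

  count-absent : ∀ {u v x y} (p : Walk u v) → x ∉ vertices p → count p (edge#ℕ x y) ≡ 0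
  count-absent ε x∉ = refl
  count-absent {x = x} {y} (_◅_ {a} {b} e p) x∉ =
    cong₂ _+_ (δ-≢ (different ∘ edge#-injective a b x y ∘ Fin.toℕ-injective)) (count-absent p (x∉ ∘ there))
    where
    different : ¬ ((a ≡ x × b ≡ y) ⊎ (a ≡ y × b ≡ x))
    different (inj₁ (refl , _)) = x∉ (here refl)
    different (inj₂ (_ , refl)) = x∉ (there (start∈ p))

  count-≤1 : ∀ {u v} (p : Walk u v) → Unique (vertices p) → ∀ i → count p i ≤ 1
  count-≤1 ε _ i = z≤n
  count-≤1 (_◅_ {a} {b} e p) (a∉ ∷ unique) i with edge#ℕ a b ℕ.≟ i
  ... | yes refl = ≤-reflexive (cong₂ _+_ (δ-refl (edge#ℕ a b)) (count-absent p (All¬⇒¬Any a∉)))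
  ... | no  i≢   = subst (λ z → z + count p i ≤ 1) (sym (δ-≢ i≢)) (count-≤1 p unique i)

  -- A simple walk uses only one edge at its first vertex, so the counts reveal the second vertex,
  -- and the rest follows by induction.
  same-counts : ∀ {u v} (p q : Walk u v) → Unique (vertices p) → Unique (vertices q) →
    (∀ {i} → i < order * order → count p i ≡ count q i) → vertices p ≡ vertices q
  same-counts ε ε _ _ _ = refl
  same-counts ε (_ ◅ q) _ (u∉ ∷ _) _ = contradiction (end∈ q) (All¬⇒¬Any u∉)
  same-counts (_ ◅ p) ε (u∉ ∷ _) _ _ = contradiction (end∈ p) (All¬⇒¬Any u∉)
  same-counts (_◅_ {u} {a} e p) (_◅_ {_} {b} f q) (u∉p ∷ p-unique) (u∉q ∷ q-unique) eq
    with edge#ℕ u b ℕ.≟ edge#ℕ u a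
  ... | no b≢a = contradiction (trans (sym edge-used) edge-unused) λ ()
    where
    edge-used : count (e ◅ p) (edge#ℕ u a) ≡ 1
    edge-used = cong₂ _+_ (δ-refl (edge#ℕ u a)) (count-absent p (All¬⇒¬Any u∉p))
    edge-unused : count (e ◅ p) (edge#ℕ u a) ≡ 0
    edge-unused = trans (eq (Fin.toℕ<n (edge# u a))) (cong₂ _+_ (δ-≢ b≢a) (count-absent q (All¬⇒¬Any u∉q)))
  ... | yes b≡a with edge#-injective u b u a (Fin.toℕ-injective b≡a)
  ...   | inj₂ (refl , refl) = contradiction e (~-irrefl _)
  ...   | inj₁ (_ , refl) =
    cong (u ∷_) (same-counts p q p-unique q-unique λ {i} i< → +-cancelˡ-≡ (δ (edge#ℕ u a) i) _ _ (eq i<))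

  unique-shortest-walk : ∀ {u v} (p q : Walk u v) → Shortest p → Shortest q → vertices p ≡ vertices q
  unique-shortest-walk p q sp sq = same-counts p q up uq
    (binary-injective (order * order) (count p) (count q) (count-≤1 p up) (count-≤1 q uq)
      -- Two shortest walks have the same length, hence the same remainder modulo `scale`.
      (trans (sym (remainder p up)) (trans (cong (_% scale) (≤-antisym (sp q) (sq p))) (remainder q uq))))
    where
    up : Unique (vertices p)
    up = shortest-unique p sp
    uq : Unique (vertices q)
    uq = shortest-unique q sq

    remainder : ∀ {u v} (r : Walk u v) → Unique (vertices r) → len r % scale ≡ binary (order * order) (count r)
    remainder r u = begin
      len r % scale                    ≡⟨ cong (_% scale) (len-binary r) ⟩
      (x + base-len r * scale) % scale ≡⟨ [m+kn]%n≡m%n x (base-len r) scale ⟩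
      x % scale                        ≡⟨ m<n⇒m%n≡m (binary-< (order * order) (count r) (count-≤1 r u)) ⟩
      x ∎
      where
      open ≡-Reasoning
      x : ℕ
      x = binary (order * order) (count r)

  ℓ : Vertex → Vertex → ℚ
  ℓ u v = fromℕ (weight u v)

  open Distance _~_ (λ {u} {v} _ → ℓ u v)

  walkLength-len : ∀ {u v} (p : Walk u v) → walkLength p ≡ fromℕ (len p)
  walkLength-len ε = sym fromℕ-0
  walkLength-len (_◅_ {u} {v} _ p) = trans (cong (ℓ u v ℚ.+_) (walkLength-len p)) (sym (fromℕ-+ (weight u v) (len p)))

  shortest : ∀ {u v} (p : Walk u v) → IsShortest p → Shortest p
  shortest p s q = fromℕ-cancel-≤ (subst₂ ℚ._≤_ (walkLength-len p) (walkLength-len q) (s q))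

  isShortest : ∀ {u v} (p : Walk u v) → Shortest p → IsShortest p
  isShortest p s q = subst₂ ℚ._≤_ (sym (walkLength-len p)) (sym (walkLength-len q)) (fromℕ-mono-≤ (s q))

  weighted : WeightedGraph
  weighted = record
    { graph           = G
    ; connected       = connected
    ; ℓ               = ℓ
    ; ℓ-sym           = λ {u} {v} _ → cong fromℕ (weight-sym u v)
    ; ℓ-pos           = λ {u} {v} _ → fromℕ-pos (weight-pos u v)
    ; unique-shortest = λ p q sp sq → unique-shortest-walk p q (shortest p sp) (shortest q sq)
    }

  metric : (∀ {u v} → u ~ v → (p : Walk u v) → weight u v ≤ len p) → IsMetric weighted
  metric direct {u} {v} e =
    e ◅ ε , isShortest (e ◅ ε) (λ q → subst (_≤ len q) (sym (+-identityʳ _)) (direct e q)) , ℚ.+-identityʳ (ℓ u v)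

-- Shortest path trees and cuts

ℚ-cancelʳ-≤ : ∀ r {p q} → p ℚ.+ r ℚ.≤ q ℚ.+ r → p ℚ.≤ q
ℚ-cancelʳ-≤ r le = ℚ.≮⇒≥ λ q<p → ℚ.<-irrefl refl (ℚ.<-≤-trans (ℚ.+-monoˡ-< r q<p) le)

ℚ-cancelˡ-≤ : ∀ r {p q} → r ℚ.+ p ℚ.≤ r ℚ.+ q → p ℚ.≤ q
ℚ-cancelˡ-≤ r {p} {q} le = ℚ-cancelʳ-≤ r (subst₂ ℚ._≤_ (ℚ.+-comm r p) (ℚ.+-comm r q) le)

ℚ-cancelˡ-≡ : ∀ r {p q} → r ℚ.+ p ≡ r ℚ.+ q → p ≡ q
ℚ-cancelˡ-≡ r eq = ℚ.≤-antisym (ℚ-cancelˡ-≤ r (ℚ.≤-reflexive eq)) (ℚ-cancelˡ-≤ r (ℚ.≤-reflexive (sym eq)))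

p≤p+q : ∀ p {q} → 0ℚ ℚ.≤ q → p ℚ.≤ p ℚ.+ q
p≤p+q p {q} 0≤q = subst (ℚ._≤ p ℚ.+ q) (ℚ.+-identityʳ p) (ℚ.+-monoʳ-≤ p 0≤q)

p<p+q : ∀ p {q} → 0ℚ ℚ.< q → p ℚ.< p ℚ.+ q
p<p+q p {q} 0<q = subst (ℚ._< p ℚ.+ q) (ℚ.+-identityʳ p) (ℚ.+-monoʳ-< p 0<q)

p≤∣p∣ : ∀ p → p ℚ.≤ ℚ.∣ p ∣
p≤∣p∣ p = [ (λ 0≤p → ℚ.≤-reflexive (sym (ℚ.0≤p⇒∣p∣≡p 0≤p))) , (λ p≤0 → ℚ.≤-trans p≤0 (ℚ.0≤∣p∣ p)) ]′
  (ℚ.≤-total 0ℚ p)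

p+[q-p]≡q : ∀ p q → p ℚ.+ (q ℚ.- p) ≡ q
p+[q-p]≡q p q = begin
  p ℚ.+ (q ℚ.- p)       ≡⟨ cong (p ℚ.+_) (ℚ.+-comm q (ℚ.- p)) ⟩
  p ℚ.+ (ℚ.- p ℚ.+ q)   ≡⟨ sym (ℚ.+-assoc p (ℚ.- p) q) ⟩
  p ℚ.- p ℚ.+ q         ≡⟨ cong (ℚ._+ q) (ℚ.+-inverseʳ p) ⟩
  0ℚ ℚ.+ q              ≡⟨ ℚ.+-identityˡ q ⟩
  q ∎
  where open ≡-Reasoning

∣p-q∣≡∣q-p∣ : ∀ p q → ℚ.∣ p ℚ.- q ∣ ≡ ℚ.∣ q ℚ.- p ∣
∣p-q∣≡∣q-p∣ p q = trans (sym (ℚ.∣-p∣≡∣p∣ (p ℚ.- q))) (cong ℚ.∣_∣ (ℚ-cancelˡ-≡ (p ℚ.- q)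
  (trans (ℚ.+-inverseʳ (p ℚ.- q)) (sym cancel))))
  where
  cancel : (p ℚ.- q) ℚ.+ (q ℚ.- p) ≡ 0ℚ
  cancel = begin
    (p ℚ.- q) ℚ.+ (q ℚ.- p)     ≡⟨ ℚ.+-assoc p (ℚ.- q) (q ℚ.- p) ⟩
    p ℚ.+ (ℚ.- q ℚ.+ (q ℚ.- p)) ≡⟨ cong (p ℚ.+_) (sym (ℚ.+-assoc (ℚ.- q) q (ℚ.- p))) ⟩
    p ℚ.+ (ℚ.- q ℚ.+ q ℚ.- p)   ≡⟨ cong (λ z → p ℚ.+ (z ℚ.- p)) (ℚ.+-inverseˡ q) ⟩
    p ℚ.+ (0ℚ ℚ.- p)            ≡⟨ cong (p ℚ.+_) (ℚ.+-identityˡ (ℚ.- p)) ⟩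
    p ℚ.- p                     ≡⟨ ℚ.+-inverseʳ p ⟩
    0ℚ ∎
    where open ≡-Reasoning

q≤p+∣p-q∣ : ∀ p q → q ℚ.≤ p ℚ.+ ℚ.∣ p ℚ.- q ∣
q≤p+∣p-q∣ p q = subst₂ ℚ._≤_ (p+[q-p]≡q p q) (cong (p ℚ.+_) (∣p-q∣≡∣q-p∣ q p))
  (ℚ.+-monoʳ-≤ p (p≤∣p∣ (q ℚ.- p)))

p≤q⇒q≡p+∣p-q∣ : ∀ {p q} → p ℚ.≤ q → q ≡ p ℚ.+ ℚ.∣ p ℚ.- q ∣
p≤q⇒q≡p+∣p-q∣ {p} {q} p≤q = sym (begin
  p ℚ.+ ℚ.∣ p ℚ.- q ∣ ≡⟨ cong (p ℚ.+_) (∣p-q∣≡∣q-p∣ p q) ⟩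
  p ℚ.+ ℚ.∣ q ℚ.- p ∣ ≡⟨ cong (p ℚ.+_) (ℚ.0≤p⇒∣p∣≡p nonneg) ⟩
  p ℚ.+ (q ℚ.- p)     ≡⟨ p+[q-p]≡q p q ⟩
  q ∎)
  where
  open ≡-Reasoning
  nonneg : 0ℚ ℚ.≤ q ℚ.- p
  nonneg = subst (ℚ._≤ q ℚ.- p) (ℚ.+-inverseʳ p) (ℚ.+-monoˡ-≤ (ℚ.- p) p≤q)

vertices-∷ʳ : {V : Set} {R : Rel V 0ℓ} {u v w : V} (p : Star R u v) (e : R v w) →
  vertices (p ◅◅ (e ◅ ε)) ≡ vertices p ∷ʳ w
vertices-∷ʳ ε       e = refl
vertices-∷ʳ (_ ◅ p) e = cong (_ ∷_) (vertices-∷ʳ p e)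

vertices-last : {V : Set} {R : Rel V 0ℓ} {u v : V} (p : Star R u v) → ∃[ xs ] vertices p ≡ xs ∷ʳ v
vertices-last ε       = [] , refl
vertices-last (_ ◅ p) with vertices-last p
... | xs , eq = _ ∷ xs , cong (_ ∷_) eq

module WalkLength {V : Set} (_~_ : Rel V 0ℓ) (weight : ∀ {u v} → u ~ v → ℚ) where
  open Distance _~_ weight

  walkLength-◅◅ : ∀ {u v w} (p : Star _~_ u v) (q : Star _~_ v w) →
    walkLength (p ◅◅ q) ≡ walkLength p ℚ.+ walkLength q
  walkLength-◅◅ ε       q = sym (ℚ.+-identityˡ _)
  walkLength-◅◅ (e ◅ p) q =
    trans (cong (weight e ℚ.+_) (walkLength-◅◅ p q)) (sym (ℚ.+-assoc (weight e) (walkLength p) (walkLength q)))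

  prefix-shortest : ∀ {u v w} (p : Star _~_ u v) (q : Star _~_ v w) → IsShortest (p ◅◅ q) → IsShortest p
  prefix-shortest p q sh r = ℚ-cancelʳ-≤ (walkLength q)
    (subst₂ ℚ._≤_ (walkLength-◅◅ p q) (walkLength-◅◅ r q) (sh (r ◅◅ q)))

  walkLength-nonneg : (∀ {u v} (e : u ~ v) → 0ℚ ℚ.≤ weight e) → ∀ {u v} (p : Star _~_ u v) → 0ℚ ℚ.≤ walkLength p
  walkLength-nonneg nonneg ε       = ℚ.≤-refl
  walkLength-nonneg nonneg (e ◅ p) = ℚ.+-mono-≤ (nonneg e) (walkLength-nonneg nonneg p)

-- The shortest paths are a parameter: from the centre of a star they are explicit, for other
-- sources they are obtained only up to double negation.
module SkeletonTree (G : WeightedGraph) (s : WeightedGraph.Vertex G)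
  (path : ∀ v → Σ (Star (WeightedGraph._~_ G) s v) (WeightedGraph.IsShortest G)) where

  open WeightedGraph G
  open WalkLength _~_ (λ {u} {v} _ → ℓ u v)
  module T = ShortestPathTree G s
  open T using (Point; node; inner; OnEdge; tail; head; between; Segment; segmentLength; Along; Descendant; Parent; Cut)

  d : Vertex → ℚ
  d v = walkLength (proj₁ (path v))

  shortest-length : ∀ {v} (p : Star _~_ s v) → IsShortest p → walkLength p ≡ d v
  shortest-length {v} p sh = ℚ.≤-antisym (sh (proj₁ (path v))) (proj₂ (path v) p)

  d-root : d s ≡ 0ℚ
  d-root = ℚ.≤-antisym (proj₂ (path s) ε) (walkLength-nonneg (ℚ.<⇒≤ ∘ ℓ-pos) (proj₁ (path s)))

  d-parent : ∀ {u v} → Parent u v → d v ≡ d u ℚ.+ ℓ u v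
  d-parent {u} {v} (p , e , sh) = begin
    d v                                  ≡⟨ sym (shortest-length (p ◅◅ (e ◅ ε)) sh) ⟩
    walkLength (p ◅◅ (e ◅ ε))            ≡⟨ walkLength-◅◅ p (e ◅ ε) ⟩
    walkLength p ℚ.+ (ℓ u v ℚ.+ 0ℚ)
      ≡⟨ cong₂ ℚ._+_ (shortest-length p (prefix-shortest p (e ◅ ε) sh)) (ℚ.+-identityʳ (ℓ u v)) ⟩
    d u ℚ.+ ℓ u v ∎
    where open ≡-Reasoning

  d-parent-< : ∀ {u v} → Parent u v → d u ℚ.< d v
  d-parent-< {u} pa@(_ , e , _) = subst (d u ℚ.<_) (sym (d-parent pa)) (p<p+q (d u) (ℓ-pos e))

  -- A potential on the realization: along a segment it grows by at most the length, and by exactly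
  -- the length when the segment leads away from the root. Distances to descendants can thus be read
  -- off without analysing arbitrary walks between points.
  depth : Point → ℚ
  depth (node v)      = d v
  depth (inner u v α) = d u ℚ.+ α

  depth-on-edge : ∀ {u v α x} → Parent u v → OnEdge u v α x → depth x ≡ d u ℚ.+ α
  depth-on-edge {u} pa tail          = sym (ℚ.+-identityʳ (d u))
  depth-on-edge     pa head          = d-parent pa
  depth-on-edge     pa (between _ _) = refl

  depth-segment : ∀ {x y} (σ : Segment x y) → depth y ℚ.≤ depth x ℚ.+ segmentLength σ
  depth-segment σ@record { u = u ; arc = pa ; α = α ; β = β ; x-at = x-at ; y-at = y-at }
    rewrite depth-on-edge pa x-at | depth-on-edge pa y-at | ℚ.+-assoc (d u) α (segmentLength σ) =
    ℚ.+-monoʳ-≤ (d u) (q≤p+∣p-q∣ α β)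

  depth-along : ∀ {x y} (σ : Segment x y) → Along σ → depth y ≡ depth x ℚ.+ segmentLength σ
  depth-along σ@record { u = u ; arc = pa ; α = α ; β = β ; x-at = x-at ; y-at = y-at } α≤β
    rewrite depth-on-edge pa x-at | depth-on-edge pa y-at | ℚ.+-assoc (d u) α (segmentLength σ) =
    cong (d u ℚ.+_) (p≤q⇒q≡p+∣p-q∣ α≤β)

  depth-walk : ∀ {x y} (p : Star Segment x y) → depth y ℚ.≤ depth x ℚ.+ T.walkLength p
  depth-walk {x} ε = ℚ.≤-reflexive (sym (ℚ.+-identityʳ (depth x)))
  depth-walk {x} {z} (_◅_ {j = y} σ p) = begin
    depth z                                             ≤⟨ depth-walk p ⟩
    depth y ℚ.+ T.walkLength p                          ≤⟨ ℚ.+-monoˡ-≤ (T.walkLength p) (depth-segment σ) ⟩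
    depth x ℚ.+ segmentLength σ ℚ.+ T.walkLength p      ≡⟨ ℚ.+-assoc (depth x) (segmentLength σ) (T.walkLength p) ⟩
    depth x ℚ.+ (segmentLength σ ℚ.+ T.walkLength p) ∎
    where open ℚ.≤-Reasoning

  descent : ∀ {x w} → Descendant x w → Σ (Star Segment x w) λ p → depth w ≡ depth x ℚ.+ T.walkLength p
  descent {x} ε = ε , sym (ℚ.+-identityʳ (depth x))
  descent {x} (_◅_ {j = y} (σ , along) c) with descent c
  ... | p , eq = σ ◅ p , trans eq (trans (cong (ℚ._+ T.walkLength p) (depth-along σ along))
                                         (ℚ.+-assoc (depth x) (segmentLength σ) (T.walkLength p)))

  -- No walk gains more depth than its length, and the descending chain attains this bound.
  descendant-distance : ∀ {x w b} → Descendant x w → T.HasDistance x w b → depth w ≡ depth x ℚ.+ b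
  descendant-distance {x} c (p , sh , refl) = ℚ.≤-antisym (depth-walk p)
    (subst (depth x ℚ.+ T.walkLength p ℚ.≤_) (sym (proj₂ (descent c)))
      (ℚ.+-monoʳ-≤ (depth x) (sh (proj₁ (descent c)))))

  distance-of-descendant : ∀ {x w} (c : Descendant x w) → T.HasDistance x w (T.walkLength (proj₁ (descent c)))
  distance-of-descendant {x} c = proj₁ (descent c) ,
    (λ q → ℚ-cancelˡ-≤ (depth x) (subst (ℚ._≤ _) (proj₂ (descent c)) (depth-walk q))) , refl

  -- Excludes the elements of Point that name no point of the tree.
  Valid : Point → Set
  Valid (node v)      = ⊤
  Valid (inner u v α) = Parent u v × 0ℚ ℚ.< α × α ℚ.< ℓ u v

  valid-end : ∀ {x y} → Segment x y → Valid y
  valid-end record { y-at = tail }                   = tt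
  valid-end record { y-at = head }                   = tt
  valid-end record { arc = pa ; y-at = between p q } = pa , p , q

  valid-walk : ∀ {x y} → Valid x → Star Segment x y → Valid y
  valid-walk valid ε       = valid
  valid-walk valid (σ ◅ p) = valid-walk (valid-end σ) p

  edge-descent : ∀ {u v} → Parent u v → Descendant (node u) (node v)
  edge-descent pa@(_ , e , _) =
    (record { arc = pa ; α = 0ℚ ; β = _ ; x-at = tail ; y-at = head } , ℚ.<⇒≤ (ℓ-pos e)) ◅ ε

  shortest-path-descent : ∀ {u v} (p : Star _~_ s u) (q : Star _~_ u v) → IsShortest (p ◅◅ q) →
    Star Parent u v
  shortest-path-descent p ε       sh = ε
  shortest-path-descent p (e ◅ q) sh =
    (p , e , prefix-shortest (p ◅◅ (e ◅ ε)) q sh′) ◅ shortest-path-descent (p ◅◅ (e ◅ ε)) q sh′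
    where
    sh′ : IsShortest ((p ◅◅ (e ◅ ε)) ◅◅ q)
    sh′ = subst IsShortest (sym (◅◅-assoc p (e ◅ ε) q)) sh

  from-root : ∀ {x} → Valid x → Descendant (node s) x
  from-root {node v}      _ = Star.kleisliStar node edge-descent (shortest-path-descent ε (proj₁ (path v)) (proj₂ (path v)))
  from-root {inner u v α} (pa , 0<α , α<ℓ) = from-root {node u} tt ◅◅
    ((record { arc = pa ; α = 0ℚ ; β = α ; x-at = tail ; y-at = between 0<α α<ℓ } , ℚ.<⇒≤ 0<α) ◅ ε)

  root-distance : ∀ {x r} → T.HasDistance (node s) x r → Valid x × depth x ≡ r
  root-distance {x} {r} h@(p , _) = valid , (begin
    depth x     ≡⟨ descendant-distance (from-root valid) h ⟩
    d s ℚ.+ r   ≡⟨ cong (ℚ._+ r) d-root ⟩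
    0ℚ ℚ.+ r    ≡⟨ ℚ.+-identityˡ r ⟩
    r ∎)
    where
    open ≡-Reasoning
    valid : Valid x
    valid = valid-walk tt p

  has-root-distance : ∀ {x} → Valid x → T.HasDistance (node s) x (depth x)
  has-root-distance {x} valid = subst (T.HasDistance (node s) x) length≡depth (distance-of-descendant (from-root valid))
    where
    length≡depth : T.walkLength (proj₁ (descent (from-root valid))) ≡ depth x
    length≡depth = sym (trans (proj₂ (descent (from-root valid)))
      (trans (cong (ℚ._+ T.walkLength (proj₁ (descent (from-root valid)))) d-root) (ℚ.+-identityˡ _)))

  -- The far end of the edge carrying the point, seen from the root. It translates descendants among
  -- points into chains of vertices.
  below : Point → Vertex
  below (node v)      = v
  below (inner u v α) = v

  depth-≤-below : ∀ {x} → Valid x → depth x ℚ.≤ d (below x)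
  depth-≤-below {node v}      _              = ℚ.≤-refl
  depth-≤-below {inner u v α} (pa , _ , α<ℓ) =
    subst (d u ℚ.+ α ℚ.≤_) (sym (d-parent pa)) (ℚ.+-monoʳ-≤ (d u) (ℚ.<⇒≤ α<ℓ))

  -- Only leaving the tail of an edge changes `below`, by one step to the head; the combinations
  -- that run backwards contradict `Along`.
  below-segment : ∀ {x y} (σ : Segment x y) → Along σ → Star Parent (below x) (below y)
  below-segment record { arc = pa ; x-at = tail ; y-at = tail } _ = ε
  below-segment record { arc = pa ; x-at = tail ; y-at = head } _ = pa ◅ ε
  below-segment record { arc = pa ; x-at = tail ; y-at = between _ _ } _ = pa ◅ ε
  below-segment record { arc = _ , e , _ ; x-at = head ; y-at = tail } ℓ≤0 =
    contradiction (ℚ.<-≤-trans (ℓ-pos e) ℓ≤0) (ℚ.<-irrefl refl)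
  below-segment record { x-at = head ; y-at = head } _ = ε
  below-segment record { x-at = head ; y-at = between _ β<ℓ } ℓ≤β =
    contradiction (ℚ.<-≤-trans β<ℓ ℓ≤β) (ℚ.<-irrefl refl)
  below-segment record { x-at = between 0<α _ ; y-at = tail } α≤0 =
    contradiction (ℚ.<-≤-trans 0<α α≤0) (ℚ.<-irrefl refl)
  below-segment record { x-at = between _ _ ; y-at = head } _ = ε
  below-segment record { x-at = between _ _ ; y-at = between _ _ } _ = ε

  below-descendant : ∀ {x w} → Descendant x w → Star Parent (below x) (below w)
  below-descendant ε                 = ε
  below-descendant ((σ , along) ◅ c) = below-segment σ along ◅◅ below-descendant c

  parent-unique : ∀ {u u′ v} → Parent u v → Parent u′ v → u ≡ u′
  parent-unique (p , e , sh) (p′ , e′ , sh′) = ∷ʳ-injectiveʳ (proj₁ (vertices-last p)) (proj₁ (vertices-last p′))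
    (trans (sym (proj₂ (vertices-last p))) (trans same (proj₂ (vertices-last p′))))
    where
    same : vertices p ≡ vertices p′
    same = ∷ʳ-injectiveˡ (vertices p) (vertices p′)
      (trans (sym (vertices-∷ʳ p e)) (trans (unique-shortest _ _ sh sh′) (vertices-∷ʳ p′ e′)))

  Ancestor : Vertex → Vertex → Set
  Ancestor = Star (flip Parent)

  ancestors-comparable : ∀ {z v v′} → Ancestor z v → Ancestor z v′ → Ancestor v v′ ⊎ Ancestor v′ v
  ancestors-comparable ε p′ = inj₁ p′
  ancestors-comparable p ε  = inj₂ p
  ancestors-comparable (e ◅ p) (e′ ◅ p′) with parent-unique e e′
  ... | refl = ancestors-comparable p p′

  ancestor-≤ : ∀ {v u} → Ancestor v u → d u ℚ.≤ d v
  ancestor-≤ ε       = ℚ.≤-refl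
  ancestor-≤ (e ◅ p) = ℚ.≤-trans (ancestor-≤ p) (ℚ.<⇒≤ (d-parent-< e))

  parent-of-below-< : ∀ {x a} → Valid x → Parent a (below x) → d a ℚ.< depth x
  parent-of-below-< {node v}      _              pa = d-parent-< pa
  parent-of-below-< {inner u v α} (pa′ , 0<α , _) pa with parent-unique pa pa′
  ... | refl = p<p+q (d u) 0<α

  -- If `a′` is a proper ancestor of `a`, then the parent of `a` lies strictly above `x` but not
  -- above `x′`, against the equal depths. Otherwise both points share an edge, where depth fixes
  -- the offset. Naming the lower ends `a` and `a′` allows matching on the chain.
  depth-determines : ∀ {x x′ a a′} → Valid x → Valid x′ → depth x ≡ depth x′ →
    below x ≡ a → below x′ ≡ a′ → Ancestor a a′ → x ≡ x′
  depth-determines {node v} {node .v} _ _ _ refl refl ε = refl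
  depth-determines {node v} {inner u .v α} _ (pa , _ , α<ℓ) eq refl refl ε =
    contradiction (ℚ.+-monoʳ-< (d u) α<ℓ) (ℚ.<-irrefl (trans (sym eq) (d-parent pa)))
  depth-determines {inner u v α} {node .v} (pa , _ , α<ℓ) _ eq refl refl ε =
    contradiction (ℚ.+-monoʳ-< (d u) α<ℓ) (ℚ.<-irrefl (trans eq (d-parent pa)))
  depth-determines {inner u v α} {inner u′ .v α′} (pa , _) (pa′ , _) eq refl refl ε with parent-unique pa pa′
  ... | refl = cong (inner u v) (ℚ-cancelˡ-≡ (d u) eq)
  depth-determines {x} {x′} valid valid′ eq refl refl (pa ◅ p) = contradiction
    (ℚ.<-≤-trans (parent-of-below-< valid pa)
      (ℚ.≤-trans (ℚ.≤-reflexive eq) (ℚ.≤-trans (depth-≤-below valid′) (ancestor-≤ p))))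
    (ℚ.<-irrefl refl)

  -- This lets a point of a cut be coded by any vertex beneath it.
  common-descendant : ∀ {x x′ z} → Valid x → Valid x′ → depth x ≡ depth x′ →
    Star Parent (below x) z → Star Parent (below x′) z → x ≡ x′
  common-descendant valid valid′ eq c c′ =
    [ depth-determines valid valid′ eq refl refl , sym ∘ depth-determines valid′ valid (sym eq) refl refl ]′
      (ancestors-comparable (Star.reverse id c) (Star.reverse id c′))

  inner-determined : ∀ {u v α α′} → depth (inner u v α) ≡ depth (inner u v α′) → inner u v α ≡ inner u v α′
  inner-determined {u} {v} eq = cong (inner u v) (ℚ-cancelˡ-≡ (d u) eq)

  record CutPoint (r : ℚ) (x : Point) : Set where
    field
      valid    : Valid x
      at-depth : depth x ≡ r
      {w}      : Point
      valid-w  : Valid w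
      chain    : Star Parent (below x) (below w)
      far      : r ℚ.+ ½ ℚ.* r ℚ.≤ depth w

  cut-point : ∀ {r x} → Cut r x → CutPoint r x
  cut-point {r} {x} ((w , a , b , c , xa , wb , ½a≤b) , xr) = record
    { valid    = proj₁ (root-distance xr)
    ; at-depth = proj₂ (root-distance xr)
    ; valid-w  = valid-walk (proj₁ (root-distance xr)) (proj₁ (descent c))
    ; chain    = below-descendant c
    ; far      = subst₂ (λ y z → y ℚ.+ ½ ℚ.* y ℚ.≤ z) a≡r (sym (descendant-distance c wb))
                   (subst (λ y → a ℚ.+ ½ ℚ.* a ℚ.≤ y ℚ.+ b) (sym (proj₂ (root-distance xa))) (ℚ.+-monoʳ-≤ a ½a≤b))
    }
    where
    a≡r : a ≡ r
    a≡r = trans (sym (proj₂ (root-distance xa))) (proj₂ (root-distance xr))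

-- `P` is not assumed decidable, hence the double negation. Applied to treewidth and to lengths of
-- walks.
¬¬-minimum : ∀ {a} {P : ℕ → Set a} {m} → P m → ¬ ¬ (∃[ k ] IsMinimum P k)
¬¬-minimum {P = P} {m} p none = below (suc m) m ≤-refl p
  where
  below : ∀ n k → k < n → ¬ P k
  below (suc n) k (s≤s k≤n) pk = none (k , pk , λ j pj → ≮⇒≥ λ j<k → below n j (<-≤-trans j<k k≤n) pj)

¬¬-maximum : ∀ {a} {P : ℕ → Set a} {m} b → P m → (∀ k → P k → k ≤ b) → ¬ ¬ (∃[ k ] IsMaximum P k)
¬¬-maximum {P = P} {m} b p bounded none = above b m (m≤n+m b m) p
  where
  above : ∀ n k → b ≤ k + n → ¬ P k
  above zero k b≤k pk =
    none (k , pk , λ j pj → ≤-trans (bounded j pj) (subst (b ≤_) (+-identityʳ k) b≤k))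
  above (suc n) k b≤ pk = none (k , pk , λ j pj → ≮⇒≥ λ k<j →
    above n j (≤-trans b≤ (≤-trans (≤-reflexive (+-suc k n)) (+-monoˡ-≤ n k<j))) pj)

¬¬-finite : ∀ {n} {P : Fin n → Set} → (∀ i → ¬ ¬ P i) → ¬ ¬ (∀ i → P i)
¬¬-finite {zero}  _ k = k λ ()
¬¬-finite {suc n} h k = h zero λ p → ¬¬-finite (h ∘ suc) λ ps → k λ { zero → p ; (suc i) → ps i }

cardinality-≤ : {A : Set} {P : A → Set} {m C : ℕ} → HasCardinality P m → (code : ∀ {x} → P x → Fin C) →
  (∀ {x y} (p : P x) (q : P y) → code p ≡ code q → x ≡ y) → m ≤ C
cardinality-≤ (xs , unique , spec , refl) code code-injective =
  unique-length-≤ unique (λ x∈ → code (Equivalence.to (spec _) x∈)) (λ _ _ → code-injective _ _)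

module TrivialDecomposition (G : SimpleGraph) where
  open SimpleGraph G
  open FiniteGraph G

  point : SimpleGraph
  point = record
    { Vertex = Fin 1 ; order = 1 ; finite = ↔-refl ; _~_ = λ _ _ → ⊥ ; _~?_ = λ _ _ → no id
    ; ~-sym = λ () ; ~-irrefl = λ _ () }

  all-vertices : List Vertex
  all-vertices = map (Inverse.from finite) (allFin order)

  ∈-all : ∀ v → v ∈ all-vertices
  ∈-all v = subst (_∈ all-vertices) (Inverse.strictlyInverseʳ finite v)
    (∈-map⁺ (Inverse.from finite) (∈-allFin (vertex# v)))

  all-unique : Unique all-vertices
  all-unique = Unique.map⁺ (Injection.injective (↔⇒↣ (↔-sym finite))) (Unique.allFin⁺ order)

  decomposition : TreeDecomposition G
  decomposition = record
    { tree          = point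
    ; isTree        = (zero , λ { zero zero → ε }) , λ _ _ _ ()
    ; bag           = λ _ → all-vertices
    ; bag-unique    = λ _ → all-unique
    ; covers-vertex = λ v → zero , ∈-all v
    ; covers-edge   = λ {u} {v} _ → zero , ∈-all u , ∈-all v
    ; coherent      = λ { _ {zero} {zero} _ _ → ε }
    }

  -- The vertex `v₀` makes the single bag nonempty, so that its size is a successor, as `HasWidth`
  -- demands.
  width : Vertex → HasWidth decomposition (ℕ.pred (length all-vertices))
  width v₀ = (zero , sym length≡) , λ _ (_ , eq) → ≤-reflexive (trans (sym eq) (sym length≡))
    where
    positive : ∀ {xs} → v₀ ∈ xs → 0 < length xs
    positive (here _)  = s≤s z≤n
    positive (there _) = s≤s z≤n

    length≡ : suc (ℕ.pred (length all-vertices)) ≡ length all-vertices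
    length≡ = suc-pred (length all-vertices) {{ℕ.>-nonZero (positive (∈-all v₀))}}

  treewidth-exists : Vertex → ¬ ¬ (∃[ w ] HasTreewidth G w)
  treewidth-exists v₀ = ¬¬-minimum (decomposition , width v₀)

module Cuts (G : WeightedGraph) (s : WeightedGraph.Vertex G)
  (path : ∀ v → Σ (Star (WeightedGraph._~_ G) s v) (WeightedGraph.IsShortest G)) where

  open WeightedGraph G
  open FiniteGraph graph
  open SkeletonTree G s path
  open T using (Point; node; inner; Parent; Cut)

  above : Point → Vertex
  above (node v)      = v
  above (inner u v α) = u

  -- An edge carries at most one inner point of a given depth, and a node is coded by a pair of
  -- equal vertices, which is no edge. The bound depends on the graph; it suffices for a maximum to
  -- exist.
  cut-size-≤ : ∀ {r m} → HasCardinality (Cut r) m → m ≤ order * order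
  cut-size-≤ {r} card = cardinality-≤ card (λ {x} _ → code x)
    λ p q eq → code-injective (cut-point p) (cut-point q) eq
    where
    code : Point → Fin (order * order)
    code x = combine (vertex# (above x)) (vertex# (below x))

    decode : ∀ x y → code x ≡ code y → above x ≡ above y × below x ≡ below y
    decode x y eq =
      let p , q = Fin.combine-injective (vertex# (above x)) (vertex# (below x)) (vertex# (above y)) (vertex# (below y)) eq
      in vertex#-injective p , vertex#-injective q

    loop : ∀ {u α} → ¬ Valid (inner u u α)
    loop ((_ , e , _) , _) = ~-irrefl _ e

    code-injective : ∀ {x y} → CutPoint r x → CutPoint r y → code x ≡ code y → x ≡ y
    code-injective {node u} {node v} p q eq = cong node (proj₁ (decode (node u) (node v) eq))
    code-injective {node u} {inner v w α} p q eq with decode (node u) (inner v w α) eq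
    ... | refl , refl = contradiction (CutPoint.valid q) loop
    code-injective {inner v w α} {node u} p q eq with decode (inner v w α) (node u) eq
    ... | refl , refl = contradiction (CutPoint.valid p) loop
    code-injective {inner u v α} {inner u′ v′ α′} p q eq with decode (inner u v α) (inner u′ v′ α′) eq
    ... | refl , refl = inner-determined (trans (CutPoint.at-depth p) (sym (CutPoint.at-depth q)))

  -- A maximum needs at least one cut of known cardinality; at radius 0 it is available in every
  -- graph.
  root-cut : HasCardinality (Cut 0ℚ) 1
  root-cut = node s ∷ [] , [] ∷ [] , (λ x → mk⇔ (λ { (here refl) → in-cut }) only-root) , refl
    where
    zero-distance : T.HasDistance (node s) (node s) 0ℚ
    zero-distance = subst (T.HasDistance (node s) (node s)) d-root (has-root-distance {node s} tt)

    in-cut : Cut 0ℚ (node s)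
    in-cut = (node s , 0ℚ , 0ℚ , ε , zero-distance , zero-distance , ℚ.≤-refl) , zero-distance

    only-root : ∀ {x} → Cut 0ℚ x → x ∈ node s ∷ []
    only-root {x} (_ , h) = here (common-descendant valid tt (trans x-depth (sym d-root)) ε
      (below-descendant (from-root valid)))
      where
      valid : Valid x
      valid = proj₁ (root-distance h)
      x-depth : depth x ≡ 0ℚ
      x-depth = proj₂ (root-distance h)

module PerturbedCuts (G : SimpleGraph) (connected : IsConnected G)
  (base : SimpleGraph.Vertex G → SimpleGraph.Vertex G → ℕ) (base-sym : ∀ u v → base u v ≡ base v u) where

  open SimpleGraph G
  open Perturbed G connected base base-sym
  open ShortestPathTree weighted using (Cut)

  ShortestPaths : Vertex → Set
  ShortestPaths s = ∀ v → Σ (Walk s v) (WeightedGraph.IsShortest weighted)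

  shortest-paths-exist : ∀ s → ¬ ¬ ShortestPaths s
  shortest-paths-exist s none = ¬¬-finite
    {P = λ i → Σ (Walk s (Inverse.from finite i)) (WeightedGraph.IsShortest weighted)}
    (λ i no-path → ¬¬-minimum {P = λ k → Σ (Walk s (Inverse.from finite i)) λ p → len p ≡ k}
      (proj₂ connected s (Inverse.from finite i) , refl)
      λ { (_ , (p , refl) , minimal) → no-path (p , isShortest p λ q → minimal (len q) (q , refl)) })
    λ paths → none λ v → subst (λ z → Σ (Walk s z) (WeightedGraph.IsShortest weighted))
      (Inverse.strictlyInverseʳ finite v) (paths (vertex# v))

  module _ {C : ℕ} (bounded : ∀ s → ShortestPaths s → ∀ {r m} → HasCardinality (Cut s r) m → m ≤ C) where

    -- The inequality is stable under double negation, which removes the assumption that shortest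
    -- paths from `s` are given.
    cut-≤ : ∀ {s r m} → HasCardinality (Cut s r) m → m ≤ C
    cut-≤ {s} card = ≮⇒≥ λ C<m → shortest-paths-exist s λ path → <⇒≱ C<m (bounded s path card)

    skeleton-dimension-exists : ¬ ¬ (∃[ k ] HasSkeletonDimension weighted k)
    skeleton-dimension-exists none = shortest-paths-exist s₀ λ path →
      ¬¬-maximum C (s₀ , 0ℚ , ℚ.≤-refl , Cuts.root-cut weighted s₀ path)
        (λ _ (_ , _ , _ , card) → cut-≤ card) none
      where
      s₀ : Vertex
      s₀ = proj₁ connected

    skeleton-dimension-≤ : ∀ {k} → HasSkeletonDimension weighted k → k ≤ C
    skeleton-dimension-≤ ((_ , _ , _ , card) , _) = cut-≤ card

-- Stars

module StarGraph (m : ℕ) where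

  n : ℕ
  n = suc m

  data _~_ : Fin (suc n) → Fin (suc n) → Set where
    out : ∀ i → zero ~ suc i
    inn : ∀ i → suc i ~ zero

  star : SimpleGraph
  star = record
    { Vertex   = Fin (suc n)
    ; order    = suc n
    ; finite   = ↔-refl
    ; _~_      = _~_
    ; _~?_     = λ { zero zero → no λ () ; zero (suc i) → yes (out i)
                   ; (suc i) zero → yes (inn i) ; (suc _) (suc _) → no λ () }
    ; ~-sym    = λ { (out i) → inn i ; (inn i) → out i }
    ; ~-irrefl = λ { zero () ; (suc _) () }
    }

  to-centre : ∀ u → Star _~_ u zero
  to-centre zero    = ε
  to-centre (suc i) = inn i ◅ ε

  from-centre : ∀ u → Star _~_ zero u
  from-centre zero    = ε
  from-centre (suc i) = out i ◅ ε

  connected : IsConnected star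
  connected = zero , λ u v → to-centre u ◅◅ from-centre v

  acyclic : IsAcyclic star
  acyclic ε _ (s≤s ())
  acyclic (_ ◅ ε) _ (s≤s (s≤s ()))
  acyclic (out i ◅ inn .i ◅ p) (0∉ ∷ _) _ _ = All¬⇒¬Any 0∉ (there (start∈ p))
  acyclic (inn i ◅ out j ◅ p) (_ ∷ 0∉ ∷ _) _ (out .i) = All¬⇒¬Any 0∉ (end∈ p)

  bag : Fin (suc n) → List (Fin (suc n))
  bag zero    = zero ∷ []
  bag (suc i) = zero ∷ suc i ∷ []

  zero∈bag : ∀ t → zero ∈ bag t
  zero∈bag zero    = here refl
  zero∈bag (suc _) = here refl

  bag-of-leaf : ∀ {i} t → suc i ∈ bag t → t ≡ suc i
  bag-of-leaf zero    (there ())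
  bag-of-leaf (suc _) (there (here refl)) = refl

  decomposition : TreeDecomposition star
  decomposition = record
    { tree          = star
    ; isTree        = connected , acyclic
    ; bag           = bag
    ; bag-unique    = λ { zero → [] ∷ [] ; (suc i) → ((λ ()) ∷ []) ∷ [] ∷ [] }
    ; covers-vertex = λ { zero → zero , here refl ; (suc i) → suc i , there (here refl) }
    ; covers-edge   = λ { (out i) → suc i , here refl , there (here refl)
                        ; (inn i) → suc i , there (here refl) , here refl }
    ; coherent      = λ { zero _ _ → Star.map (λ e → e , zero∈bag _ , zero∈bag _) (proj₂ connected _ _)
                        ; (suc i) → leaf }
    }
    where
    leaf : ∀ {i t t′} → suc i ∈ bag t → suc i ∈ bag t′ →
      Star (λ a b → a ~ b × suc i ∈ bag a × suc i ∈ bag b) t t′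
    leaf {i} {t} {t′} p q with bag-of-leaf t p | bag-of-leaf t′ q
    ... | refl | refl = ε

  treewidth-≤1 : ∀ {w} → HasTreewidth star w → w ≤ 1
  treewidth-≤1 (_ , minimal) = minimal 1 (decomposition , (suc zero , refl) ,
    λ { _ (zero , refl) → s≤s z≤n ; _ (suc _ , refl) → s≤s (s≤s z≤n) })

  open Perturbed star connected (λ _ _ → 1) (λ _ _ → refl)
  open PerturbedCuts star connected (λ _ _ → 1) (λ _ _ → refl)

  -- The last edge of a walk into a leaf is the edge from the centre.
  into-leaf : ∀ {i} (p : Walk zero (suc i)) → weight zero (suc i) ≤ len p
  into-leaf (out i ◅ ε)             = m≤m+n (weight zero (suc i)) 0
  into-leaf (out i ◅ (inn .i ◅ p)) = ≤-trans (into-leaf p)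
    (≤-trans (m≤n+m (len p) (weight (suc i) zero)) (m≤n+m _ (weight zero (suc i))))

  isMetric : IsMetric weighted
  isMetric = metric λ
    { (out i) p → into-leaf p
    ; (inn i) p → subst₂ _≤_ (weight-sym zero (suc i)) (len-reverse p) (into-leaf (reverse p)) }

  path : ShortestPaths zero
  path zero    = ε , isShortest ε (λ _ → z≤n)
  path (suc i) = out i ◅ ε , isShortest (out i ◅ ε) λ q → subst (_≤ len q) (sym (+-identityʳ _)) (into-leaf q)

  open SkeletonTree weighted zero path
  open T using (Point; node; inner; head; between; Parent; Cut; Descendant)

  parent : ∀ i → Parent zero (suc i)
  parent i = ε , out i , proj₂ (path (suc i))

  0<½ : 0ℚ ℚ.< ½
  0<½ = from-yes (0ℚ ℚ.<? ½)

  ½<ℓ : ∀ i → ½ ℚ.< ℓ zero (suc i)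
  ½<ℓ i = ℚ.<-≤-trans (from-yes (½ ℚ.<? ℚ.1ℚ)) (fromℕ-≥1 (weight-pos zero (suc i)))

  -- The point is at distance ½ from the centre, in general not halfway. Edge lengths are positive
  -- integers, so at least ½ of the edge remains beyond it, more than the required ¼.
  midpoint : Fin n → Point
  midpoint i = inner zero (suc i) ½

  midpoint-valid : ∀ i → Valid (midpoint i)
  midpoint-valid i = parent i , 0<½ , ½<ℓ i

  midpoint-in-cut : ∀ i → Cut ½ (midpoint i)
  midpoint-in-cut i = (node (suc i) , ½ , _ , to-leaf , at-½ , distance-of-descendant to-leaf , far) , at-½
    where
    at-½ : T.HasDistance (node zero) (midpoint i) ½
    at-½ = subst (T.HasDistance (node zero) (midpoint i)) (ℚ.+-identityˡ ½) (has-root-distance (midpoint-valid i))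

    to-leaf : Descendant (midpoint i) (node (suc i))
    to-leaf = (record { arc = parent i ; α = ½ ; β = _ ; x-at = between 0<½ (½<ℓ i) ; y-at = head } , ℚ.<⇒≤ (½<ℓ i)) ◅ ε

    rest : ℚ
    rest = T.walkLength (proj₁ (descent to-leaf))

    far : ½ ℚ.* ½ ℚ.≤ rest
    far = ℚ-cancelˡ-≤ ½ (begin
      ½ ℚ.+ ½ ℚ.* ½          ≤⟨ from-yes (½ ℚ.+ ½ ℚ.* ½ ℚ.≤? ℚ.1ℚ) ⟩
      ℚ.1ℚ                   ≤⟨ fromℕ-≥1 (weight-pos zero (suc i)) ⟩
      ℓ zero (suc i)         ≡⟨ sym (ℚ.+-identityʳ (ℓ zero (suc i))) ⟩
      d (suc i)              ≡⟨ proj₂ (descent to-leaf) ⟩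
      (0ℚ ℚ.+ ½) ℚ.+ rest    ≡⟨ cong (ℚ._+ rest) (ℚ.+-identityˡ ½) ⟩
      ½ ℚ.+ rest ∎)
      where open ℚ.≤-Reasoning

  -- `HasCardinality` asks for an exact enumeration, so even a lower bound on the skeleton dimension
  -- requires all points of this cut.
  cut-midpoint : ∀ {x} → Cut ½ x → ∃[ i ] x ≡ midpoint i
  cut-midpoint {node zero} c = contradiction (CutPoint.at-depth (cut-point c)) (from-yes (¬? (0ℚ ℚ.≟ ½)))
  cut-midpoint {node (suc i)} c = contradiction
    (subst (½ ℚ.<_) (trans (sym (ℚ.+-identityʳ (ℓ zero (suc i)))) (CutPoint.at-depth (cut-point c))) (½<ℓ i))
    (ℚ.<-irrefl refl)
  cut-midpoint {inner u v α} c with CutPoint.valid (cut-point c) | CutPoint.at-depth (cut-point c)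
  ... | (_ , out i , _) , _ | eq = i , cong (inner zero (suc i)) (trans (sym (ℚ.+-identityˡ α)) eq)
  -- An arc from a leaf to the centre would make the root deeper than that leaf.
  ... | pa@(_ , inn i , _) , _ | _ = contradiction
    (ℚ.<-trans (d-parent-< pa)
      (subst (0ℚ ℚ.<_) (sym (ℚ.+-identityʳ (ℓ zero (suc i)))) (fromℕ-pos (weight-pos zero (suc i)))))
    (ℚ.<-irrefl refl)

  half-cut : HasCardinality (Cut ½) n
  half-cut = map midpoint (allFin n) ,
    Unique.map⁺ (λ { refl → refl }) (Unique.allFin⁺ n) ,
    (λ x → mk⇔ (λ x∈ → let i , _ , eq = ∈-map⁻ midpoint x∈ in subst (Cut ½) (sym eq) (midpoint-in-cut i))
               (λ c → let i , eq = cut-midpoint c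
                      in subst (_∈ map midpoint (allFin n)) (sym eq) (∈-map⁺ midpoint (∈-allFin i)))) ,
    trans (length-map midpoint (allFin n)) (length-tabulate id)

  skeleton-dimension-≥ : ∀ {k} → HasSkeletonDimension weighted k → n ≤ k
  skeleton-dimension-≥ (_ , maximal) = maximal n (zero , ½ , ℚ.<⇒≤ 0<½ , half-cut)

skeleton-dimension-unbounded :
  ¬ IsBoundedBy IsMetric HasSkeletonDimension (λ G → HasTreewidth (WeightedGraph.graph G))
skeleton-dimension-unbounded (f , bound) =
  TrivialDecomposition.treewidth-exists star zero λ (w , tw) →
  skeleton-dimension-exists (λ s path → Cuts.cut-size-≤ weighted s path) λ (k , κ) →
  <⇒≱ (s≤s (small (treewidth-≤1 tw))) (≤-trans (skeleton-dimension-≥ κ) (bound weighted isMetric k w κ tw))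
  where
  -- The treewidth is only known to be at most 1, so the number of legs, `f 0 + f 1` plus one, has
  -- to beat both values of `f`.
  open StarGraph (f 0 + f 1)
  open Perturbed star connected (λ _ _ → 1) (λ _ _ → refl)
  open PerturbedCuts star connected (λ _ _ → 1) (λ _ _ → refl)

  small : ∀ {w} → w ≤ 1 → f w ≤ f 0 + f 1
  small z≤n       = m≤m+n _ _
  small (s≤s z≤n) = m≤n+m _ _

-- Skip lists

Σ-suc : ∀ {n} {F : Fin (suc n) → Set} → Σ (Fin (suc n)) F ↔ (F zero ⊎ Σ (Fin n) (F ∘ suc))
Σ-suc = mk↔ₛ′ (λ { (zero , x) → inj₁ x ; (suc i , x) → inj₂ (i , x) })
              (λ { (inj₁ x) → zero , x ; (inj₂ (i , x)) → suc i , x })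
              (λ { (inj₁ _) → refl ; (inj₂ _) → refl })
              (λ { (zero , _) → refl ; (suc _ , _) → refl })

total : ∀ n → (Fin n → ℕ) → ℕ
total zero    N = 0
total (suc n) N = N zero + total n (N ∘ suc)

Σ-finite : ∀ n (N : Fin n → ℕ) → Σ (Fin n) (Fin ∘ N) ↔ Fin (total n N)
Σ-finite zero    N = mk↔ₛ′ (λ ()) (λ ()) (λ ()) λ ()
Σ-finite (suc n) N = ↔-sym Fin.+↔⊎ ↔-∘ ((↔-refl ⊎-↔ Σ-finite n (N ∘ suc)) ↔-∘ Σ-suc)

mod-injective : ∀ {a b m} .{{_ : ℕ.NonZero m}} → a mod m ≡ b mod m → ∣ a - b ∣ < m → a ≡ b
mod-injective {a} {b} {m} eq close = begin
  a                     ≡⟨ m≡m%n+[m/n]*n a m ⟩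
  a % m + a / m * m     ≡⟨ cong₂ (λ r q → r + q * m) same-% same-/ ⟩
  b % m + b / m * m     ≡⟨ sym (m≡m%n+[m/n]*n b m) ⟩
  b ∎
  where
  open ≡-Reasoning
  same-% : a % m ≡ b % m
  same-% = trans (sym (Fin.toℕ-fromℕ< (m%n<n a m))) (trans (cong toℕ eq) (Fin.toℕ-fromℕ< (m%n<n b m)))
  difference : ∣ a - b ∣ ≡ ∣ a / m - b / m ∣ * m
  difference = begin
    ∣ a - b ∣
      ≡⟨ cong₂ ∣_-_∣ (m≡m%n+[m/n]*n a m) (m≡m%n+[m/n]*n b m) ⟩
    ∣ a % m + a / m * m - b % m + b / m * m ∣
      ≡⟨ cong (λ r → ∣ a % m + a / m * m - r + b / m * m ∣) (sym same-%) ⟩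
    ∣ a % m + a / m * m - a % m + b / m * m ∣
      ≡⟨ ∣m+n-m+o∣≡∣n-o∣ (a % m) (a / m * m) (b / m * m) ⟩
    ∣ a / m * m - b / m * m ∣
      ≡⟨ sym (*-distribʳ-∣-∣ m (a / m) (b / m)) ⟩
    ∣ a / m - b / m ∣ * m ∎
  same-/ : a / m ≡ b / m
  same-/ = ∣m-n∣≡0⇒m≡n (n<1⇒n≡0 (*-cancelʳ-< m ∣ a / m - b / m ∣ 1
    (subst₂ _<_ difference (sym (*-identityˡ m)) close)))

n<2^n : ∀ n → n < 2 ^ n
n<2^n zero    = s≤s z≤n
n<2^n (suc n) = ≤-trans (+-mono-≤ (m^n>0 2 n) (n<2^n n)) (+-monoʳ-≤ (2 ^ n) (m≤m+n (2 ^ n) 0))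

-- Descends from `b` until the predecessor fails. The result is the least solution if `Q` is upward
-- closed, but failure of the predecessor is all that is claimed.
least : {Q : ℕ → Set} → (∀ k → Dec (Q k)) → ∀ b → Q b → ∃[ i ] Q i × (∀ j → i ≡ suc j → ¬ Q j)
least Q? zero    q = zero , q , λ _ ()
least Q? (suc b) q with Q? b
... | yes q′ = least Q? b q′
... | no ¬q  = suc b , q , λ { _ refl → ¬q }

-- The number of possible (level mod 11, index mod 8^10): nodes of level ≥ i at
-- distance less than 2^(i+10) units are told apart by these residues.
opaque
  window : ℕ
  window = 11 * 8 ^ 10

module SkipList (n : ℕ) where

  Vertex : Set
  Vertex = Σ (Fin (suc n)) λ i → Fin (8 ^ (n ∸ toℕ i))

  level index position : Vertex → ℕ
  level (i , _) = toℕ i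
  index (_ , k) = toℕ k
  position v    = index v * 8 ^ level v

  level-≤ : ∀ v → level v ≤ n
  level-≤ (i , _) = ≤-pred (Fin.toℕ<n i)

  8^n-split : ∀ {i} → i ≤ n → 8 ^ n ≡ 8 ^ (n ∸ i) * 8 ^ i
  8^n-split {i} i≤n = trans (cong (8 ^_) (sym (m∸n+n≡m i≤n))) (^-distribˡ-+-* 8 (n ∸ i) i)

  position-< : ∀ v → position v < 8 ^ n
  position-< v@(i , k) = subst (position v <_) (sym (8^n-split (level-≤ v)))
    (*-monoˡ-< (8 ^ toℕ i) {{m^n≢0 8 (toℕ i)}} (Fin.toℕ<n k))

  vertex-≡ : ∀ {u v} → level u ≡ level v → index u ≡ index v → u ≡ v
  vertex-≡ {i , k} {j , l} p q with Fin.toℕ-injective p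
  ... | refl = cong (i ,_) (Fin.toℕ-injective q)

  vertex-at : ∀ i k → i ≤ n → k * 8 ^ i < 8 ^ n → ∃[ v ] level v ≡ i × index v ≡ k
  vertex-at i k i≤n k< = (Fin.fromℕ< (s≤s i≤n) , Fin.fromℕ< k<′) , Fin.toℕ-fromℕ< (s≤s i≤n) , Fin.toℕ-fromℕ< k<′
    where
    k<′ : k < 8 ^ (n ∸ toℕ (Fin.fromℕ< (s≤s i≤n)))
    k<′ = subst (λ j → k < 8 ^ (n ∸ j)) (sym (Fin.toℕ-fromℕ< (s≤s i≤n)))
      (*-cancelʳ-< (8 ^ i) k (8 ^ (n ∸ i)) (subst (k * 8 ^ i <_) (8^n-split i≤n) k<))

  -- Node k of level i sits over position k 8^i; Step i k j l is an edge from
  -- node k of level i to node l of level j.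
  data Step (i k j l : ℕ) : Set where
    right : i ≡ j → suc k ≡ l → Step i k j l
    left  : i ≡ j → k ≡ suc l → Step i k j l
    up    : suc i ≡ j → k ≡ 8 * l → Step i k j l
    down  : i ≡ suc j → 8 * k ≡ l → Step i k j l

  step? : ∀ i k j l → Dec (Step i k j l)
  step? i k j l = map′
    (λ { (inj₁ (p , q)) → right p q ; (inj₂ (inj₁ (p , q))) → left p q
       ; (inj₂ (inj₂ (inj₁ (p , q)))) → up p q ; (inj₂ (inj₂ (inj₂ (p , q)))) → down p q })
    (λ { (right p q) → inj₁ (p , q) ; (left p q) → inj₂ (inj₁ (p , q))
       ; (up p q) → inj₂ (inj₂ (inj₁ (p , q))) ; (down p q) → inj₂ (inj₂ (inj₂ (p , q))) })
    ((i ℕ.≟ j ×-dec suc k ℕ.≟ l) ⊎-dec (i ℕ.≟ j ×-dec k ℕ.≟ suc l) ⊎-dec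
     (suc i ℕ.≟ j ×-dec k ℕ.≟ 8 * l) ⊎-dec (i ℕ.≟ suc j ×-dec 8 * k ℕ.≟ l))

  step-sym : ∀ {i k j l} → Step i k j l → Step j l i k
  step-sym (right p q) = left (sym p) (sym q)
  step-sym (left p q)  = right (sym p) (sym q)
  step-sym (up p q)    = down (sym p) (sym q)
  step-sym (down p q)  = up (sym p) (sym q)

  step-irrefl : ∀ {i k} → ¬ Step i k i k
  step-irrefl (right _ q) = 1+n≢n q
  step-irrefl (left _ q)  = 1+n≢n (sym q)
  step-irrefl (up p _)    = 1+n≢n p
  step-irrefl (down p _)  = 1+n≢n (sym p)

  infix 4 _~_
  _~_ : Vertex → Vertex → Set
  u ~ v = Step (level u) (index u) (level v) (index v)

  graph : SimpleGraph
  graph = record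
    { Vertex   = Vertex
    ; order    = total (suc n) (λ i → 8 ^ (n ∸ toℕ i))
    ; finite   = Σ-finite (suc n) (λ i → 8 ^ (n ∸ toℕ i))
    ; _~_      = _~_
    ; _~?_     = λ u v → step? (level u) (index u) (level v) (index v)
    ; ~-sym    = step-sym
    ; ~-irrefl = λ _ → step-irrefl
    }

  InRow : ℕ → Vertex → Vertex → Set
  InRow i a b = a ~ b × level a ≡ i × level b ≡ i

  steps : ∀ {R : Vertex → Vertex → Set} {u v} → Star R u v → ℕ
  steps ε       = 0
  steps (_ ◅ p) = suc (steps p)

  steps-∷ʳ : ∀ {R : Vertex → Vertex → Set} {u v w} (p : Star R u v) (e : R v w) →
    steps (p ◅◅ (e ◅ ε)) ≡ suc (steps p)
  steps-∷ʳ ε       e = refl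
  steps-∷ʳ (_ ◅ p) e = cong suc (steps-∷ʳ p e)

  row-right : ∀ m {i u v} → level u ≡ i → level v ≡ i → index v ≡ m + index u →
    Σ (Star (InRow i) u v) λ p → steps p ≡ m
  row-right zero lu lv eq with vertex-≡ (trans lu (sym lv)) (sym eq)
  ... | refl = ε , refl
  row-right (suc m) {i} {u} {v} refl lv eq
    with vertex-at (level u) (m + index u) (level-≤ u)
           (≤-<-trans (≤-trans (*-monoˡ-≤ (8 ^ level u) (≤-trans (n≤1+n _) (≤-reflexive (sym eq))))
                              (≤-reflexive (cong (λ j → index v * 8 ^ j) (sym lv)))) (position-< v))
  ... | y , ly , iy with row-right m {level u} {u} {y} refl ly iy
  ...   | p , eq′ = p ◅◅ ((right (trans ly (sym lv)) (trans (cong suc iy) (sym eq)) , ly , lv) ◅ ε) ,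
                    trans (steps-∷ʳ p _) (cong suc eq′)

  in-row-sym : ∀ {i a b} → InRow i a b → InRow i b a
  in-row-sym (e , p , q) = step-sym e , q , p

  row-connected : ∀ i {u v} → level u ≡ i → level v ≡ i → Star (InRow i) u v
  row-connected i {u} {v} lu lv with ≤-total (index u) (index v)
  ... | inj₁ u≤v = proj₁ (row-right (index v ∸ index u) lu lv (sym (m∸n+n≡m u≤v)))
  ... | inj₂ v≤u = Star.reverse in-row-sym (proj₁ (row-right (index u ∸ index v) lv lu (sym (m∸n+n≡m v≤u))))

  parent-at : ∀ v → suc (level v) ≤ n → ∀ q → 8 * q ≤ index v → ∃[ w ] level w ≡ suc (level v) × index w ≡ q
  parent-at v l<n q 8q≤ = vertex-at (suc (level v)) q l<n
    (≤-<-trans (≤-trans (≤-reflexive (regroup q (8 ^ level v))) (*-monoˡ-≤ (8 ^ level v) 8q≤)) (position-< v))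
    where
    regroup : ∀ q e → q * (8 * e) ≡ 8 * q * e
    regroup = solve-∀

  origin-of-row : ∀ i → i ≤ n → ∃[ v ] level v ≡ i × index v ≡ 0
  origin-of-row i i≤n = vertex-at i 0 i≤n (m^n>0 8 n)

  root : Vertex
  root = proj₁ (origin-of-row 0 z≤n)

  to-root : ∀ i u → level u ≡ i → Star _~_ u root
  to-root zero    u lu = Star.map proj₁ (row-connected 0 {u} {root} lu (proj₁ (proj₂ (origin-of-row 0 z≤n))))
  to-root (suc i) u lu with origin-of-row (suc i) (subst (_≤ n) lu (level-≤ u))
                          | origin-of-row i (≤-trans (n≤1+n i) (subst (_≤ n) lu (level-≤ u)))
  ... | y , ly , iy | w , lw , iw = Star.map proj₁ (row-connected (suc i) {u} {y} lu ly) ◅◅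
    (_◅_ {j = w} (down (trans ly (cong suc (sym lw))) (trans (cong (8 *_) iy) (sym iw))) (to-root i w lw))

  connected : IsConnected graph
  connected = root , λ u v → to-root _ u refl ◅◅ Star.reverse step-sym (to-root _ v refl)

  -- With the maximum, every edge at a node has at least the unit length of that node's level,
  -- including the edge to the level below; `leaving-length` relies on this.
  base : Vertex → Vertex → ℕ
  base u v = 2 ^ (level u ⊔ level v)

  base-sym : ∀ u v → base u v ≡ base v u
  base-sym u v = cong (2 ^_) (⊔-comm (level u) (level v))

  open Perturbed graph connected base base-sym public

  unit : ℕ → ℕ
  unit i = 2 ^ i * scale

  unit-suc : ∀ i → unit (suc i) ≡ 2 * unit i
  unit-suc i = *-assoc 2 (2 ^ i) scale

  unit-+ : ∀ i t → unit (i + t) ≡ 2 ^ t * unit i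
  unit-+ i t = trans (cong (_* scale) (trans (^-distribˡ-+-* 2 i t) (*-comm (2 ^ i) (2 ^ t))))
                     (*-assoc (2 ^ t) (2 ^ i) scale)

  unit-mono : ∀ {i j} → i ≤ j → unit i ≤ unit j
  unit-mono i≤j = *-monoˡ-≤ scale (^-monoʳ-≤ 2 i≤j)

  weight-lower : ∀ u v → unit (level u ⊔ level v) ≤ weight u v
  weight-lower u v = weight-≥ u v

  weight-upper : ∀ u v → weight u v ≤ 2 * unit (level u ⊔ level v)
  weight-upper u v = ≤-trans (weight-≤ u v) (+-monoʳ-≤ (unit (level u ⊔ level v))
    (≤-trans (m≤n*m scale (2 ^ (level u ⊔ level v)) {{m^n≢0 2 (level u ⊔ level v)}}) (m≤m+n _ 0)))

  leaving-length : ∀ {u v} (p : Walk u v) → u ≢ v → unit (level u) ≤ len p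
  leaving-length ε u≢v = contradiction refl u≢v
  leaving-length (_◅_ {u} {v} e p) _ =
    ≤-trans (unit-mono (m≤m⊔n (level u) (level v))) (≤-trans (weight-lower u v) (m≤m+n _ (len p)))

  arriving-length : ∀ {u v} (p : Walk u v) → u ≢ v → unit (level v) ≤ len p
  arriving-length p u≢v = subst (_ ≤_) (len-reverse p) (leaving-length (reverse p) (u≢v ∘ sym))

  -- A node has at most one neighbour on the level below. After climbing an edge, a step that does
  -- not return along it therefore stays at level `j` or above.
  other-neighbour : ∀ {i k j l i′ k′} → Step i k j l → Step j l i′ k′ → i ≤ j →
    (i′ ≡ i × k′ ≡ k) ⊎ (j ≤ i ⊎ j ≤ i′)
  other-neighbour (right refl _) _ _ = inj₂ (inj₁ ≤-refl)
  other-neighbour (left refl _)  _ _ = inj₂ (inj₁ ≤-refl)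
  other-neighbour (down refl _)  _ i≤j = contradiction i≤j 1+n≰n
  other-neighbour (up refl _) (right refl _) _ = inj₂ (inj₂ ≤-refl)
  other-neighbour (up refl _) (left refl _)  _ = inj₂ (inj₂ ≤-refl)
  other-neighbour (up refl _) (up refl _)    _ = inj₂ (inj₂ (n≤1+n _))
  other-neighbour (up refl q) (down refl q′) _ = inj₁ (refl , trans (sym q′) (sym q))

  -- Any other walk between the ends of an edge has, apart from its edge at
  -- the higher end v, a second part reaching the level of v.
  direct-from-top : ∀ {u v} → u ~ v → level u ≤ level v → (p : Walk v u) → weight v u ≤ len p
  direct-from-top e _ ε = contradiction e step-irrefl
  direct-from-top {u} {v} e u≤v (_◅_ {j = y} f p) with other-neighbour e f u≤v
  ... | inj₁ (ly , iy) = subst (λ z → weight v z ≤ weight v y + len p) (vertex-≡ ly iy) (m≤m+n _ _)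
  ... | inj₂ far with y ≟ᵥ u
  ...   | yes refl = m≤m+n _ _
  ...   | no y≢u = begin
    weight v u                     ≤⟨ weight-upper v u ⟩
    2 * unit (level v ⊔ level u)   ≡⟨ cong (λ i → 2 * unit i) (m≥n⇒m⊔n≡m u≤v) ⟩
    2 * unit (level v)             ≡⟨ cong (unit (level v) +_) (+-identityʳ _) ⟩
    unit (level v) + unit (level v)
      ≤⟨ +-mono-≤ (≤-trans (unit-mono (m≤m⊔n (level v) (level y))) (weight-lower v y)) (rest far) ⟩
    weight v y + len p ∎
    where
    open ≤-Reasoning
    rest : level v ≤ level u ⊎ level v ≤ level y → unit (level v) ≤ len p
    rest (inj₁ v≤u) = ≤-trans (unit-mono v≤u) (arriving-length p y≢u)
    rest (inj₂ v≤y) = ≤-trans (unit-mono v≤y) (leaving-length p y≢u)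

  isMetric : IsMetric weighted
  isMetric = metric direct
    where
    direct : ∀ {u v} → u ~ v → (p : Walk u v) → weight u v ≤ len p
    direct {u} {v} e p with ≤-total (level u) (level v)
    ... | inj₁ u≤v = subst₂ _≤_ (weight-sym v u) (len-reverse p) (direct-from-top e u≤v (reverse p))
    ... | inj₂ v≤u = direct-from-top (step-sym e) v≤u p

  -- Distances are bounded below by potentials changing slowly along edges.
  lipschitz : (Q : Vertex → Set) (f : Vertex → Vertex → ℕ) (c : ℕ) → (∀ u → f u u ≡ 0) →
    (∀ u v w → f u w ≤ f u v + f v w) → (∀ {u v} → Q u → u ~ v → f u v ≤ c * base u v) →
    ∀ {u v} (p : Walk u v) → All Q (vertices p) → f u v * scale ≤ c * len p
  lipschitz Q f c f-refl triangle edge {u} ε _ = subst (λ z → z * scale ≤ c * 0) (sym (f-refl u)) z≤n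
  lipschitz Q f c f-refl triangle edge {u} {w} (_◅_ {j = v} e p) (q ∷ qs) = begin
    f u w * scale                         ≤⟨ *-monoˡ-≤ scale (triangle u v w) ⟩
    (f u v + f v w) * scale               ≡⟨ *-distribʳ-+ scale (f u v) (f v w) ⟩
    f u v * scale + f v w * scale
      ≤⟨ +-mono-≤ (*-monoˡ-≤ scale (edge q e)) (lipschitz Q f c f-refl triangle edge p qs) ⟩
    c * base u v * scale + c * len p      ≡⟨ cong (_+ c * len p) (*-assoc c (base u v) scale) ⟩
    c * (base u v * scale) + c * len p    ≤⟨ +-monoˡ-≤ (c * len p) (*-monoʳ-≤ c (weight-≥ u v)) ⟩
    c * weight u v + c * len p            ≡⟨ sym (*-distribˡ-+ c (weight u v) (len p)) ⟩
    c * (weight u v + len p) ∎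
    where open ≤-Reasoning

  everywhere : ∀ {u v} (p : Walk u v) → All (λ _ → ⊤) (vertices p)
  everywhere p = All.universal (λ _ → tt) (vertices p)

  8^≡4^*2^ : ∀ i → 8 ^ i ≡ 4 ^ i * 2 ^ i
  8^≡4^*2^ zero    = refl
  8^≡4^*2^ (suc i) = trans (cong (8 *_) (8^≡4^*2^ i)) (regroup (4 ^ i) (2 ^ i))
    where
    regroup : ∀ a b → 8 * (a * b) ≡ 4 * a * (2 * b)
    regroup = solve-∀

  position-step : ∀ {i k j l} → Step i k j l → ∣ k * 8 ^ i - l * 8 ^ j ∣ ≤ 8 ^ i
  position-step {i} {k} (right refl refl) = ≤-reflexive
    (trans (cong ∣ k * 8 ^ i -_∣ (+-comm (8 ^ i) (k * 8 ^ i))) (∣m-m+n∣≡n (k * 8 ^ i) (8 ^ i)))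
  position-step {i} {l = l} (left refl refl) = ≤-reflexive
    (trans (∣-∣-comm (8 ^ i + l * 8 ^ i) (l * 8 ^ i))
      (trans (cong ∣ l * 8 ^ i -_∣ (+-comm (8 ^ i) (l * 8 ^ i))) (∣m-m+n∣≡n (l * 8 ^ i) (8 ^ i))))
  position-step {i} {l = l} (up refl refl) =
    subst (_≤ 8 ^ i) (sym (m≡n⇒∣m-n∣≡0 (regroup l (8 ^ i)))) z≤n
    where
    regroup : ∀ k e → 8 * k * e ≡ k * (8 * e)
    regroup = solve-∀
  position-step {k = k} {j} (down refl refl) =
    subst (_≤ 8 ^ suc j) (sym (m≡n⇒∣m-n∣≡0 (regroup k (8 ^ j)))) z≤n
    where
    regroup : ∀ k e → k * (8 * e) ≡ 8 * k * e
    regroup = solve-∀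

  position-edge : ∀ J {u v} → level u ≤ J → u ~ v → ∣ position u - position v ∣ ≤ 4 ^ J * base u v
  position-edge J {u} {v} u≤J e = begin
    ∣ position u - position v ∣ ≤⟨ position-step e ⟩
    8 ^ level u                 ≡⟨ 8^≡4^*2^ (level u) ⟩
    4 ^ level u * 2 ^ level u   ≤⟨ *-mono-≤ (^-monoʳ-≤ 4 u≤J) (^-monoʳ-≤ 2 (m≤m⊔n (level u) (level v))) ⟩
    4 ^ J * base u v ∎
    where open ≤-Reasoning

  position-bound-below : ∀ J {u v} (p : Walk u v) → All (λ x → level x ≤ J) (vertices p) →
    ∣ position u - position v ∣ * scale ≤ 4 ^ J * len p
  position-bound-below J = lipschitz (λ x → level x ≤ J) (λ u v → ∣ position u - position v ∣) (4 ^ J)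
    (∣n-n∣≡0 ∘ position) (λ u v w → ∣-∣-triangle (position u) (position v) (position w)) (position-edge J)

  ⊓-triangle : ∀ {a} b b′ c → a ≤ b + b′ → a ⊓ c ≤ b ⊓ c + b′ ⊓ c
  ⊓-triangle {a} b b′ c a≤ with ≤-total b c | ≤-total b′ c
  ... | inj₂ c≤b | _ rewrite m≥n⇒m⊓n≡n c≤b = ≤-trans (m⊓n≤n a c) (m≤m+n c _)
  ... | inj₁ _ | inj₂ c≤b′ rewrite m≥n⇒m⊓n≡n c≤b′ = ≤-trans (m⊓n≤n a c) (m≤n+m c _)
  ... | inj₁ b≤c | inj₁ b′≤c rewrite m≤n⇒m⊓n≡m b≤c | m≤n⇒m⊓n≡m b′≤c = ≤-trans (m⊓n≤m a c) a≤

  -- Edges of level above `J` cover more than 4^J positions per unit of length. Capping the distance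
  -- at 8^J repairs this: each of them costs at least 2^J, which at rate 4^J already pays for the
  -- cap.
  position-bound : ∀ J {u v} (p : Walk u v) → (∣ position u - position v ∣ ⊓ 8 ^ J) * scale ≤ 4 ^ J * len p
  position-bound J p = lipschitz (λ _ → ⊤) (λ u v → ∣ position u - position v ∣ ⊓ 8 ^ J) (4 ^ J)
    (λ u → cong (_⊓ 8 ^ J) (∣n-n∣≡0 (position u)))
    (λ u v w → ⊓-triangle ∣ position u - position v ∣ ∣ position v - position w ∣ (8 ^ J)
      (∣-∣-triangle (position u) (position v) (position w)))
    (λ _ → edge) p (everywhere p)
    where
    open ≤-Reasoning
    edge : ∀ {u v} → u ~ v → ∣ position u - position v ∣ ⊓ 8 ^ J ≤ 4 ^ J * base u v
    edge {u} {v} e with ≤-total (level u) J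
    ... | inj₁ u≤J = ≤-trans (m⊓n≤m _ _) (position-edge J u≤J e)
    ... | inj₂ J≤u = begin
      ∣ position u - position v ∣ ⊓ 8 ^ J ≤⟨ m⊓n≤n _ (8 ^ J) ⟩
      8 ^ J                               ≡⟨ 8^≡4^*2^ J ⟩
      4 ^ J * 2 ^ J
        ≤⟨ *-monoʳ-≤ (4 ^ J) (^-monoʳ-≤ 2 (≤-trans J≤u (m≤m⊔n (level u) (level v)))) ⟩
      4 ^ J * base u v ∎

  -- The potential 2^level changes along an edge by at most the maximum of its two end values, which
  -- is the base length of the edge.
  level-bound : ∀ {u v} (p : Walk u v) → ∣ 2 ^ level u - 2 ^ level v ∣ * scale ≤ len p
  level-bound p = subst (_ ≤_) (+-identityʳ (len p)) (lipschitz (λ _ → ⊤) (λ u v → ∣ 2 ^ level u - 2 ^ level v ∣) 1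
    (λ u → ∣n-n∣≡0 (2 ^ level u)) (λ u v w → ∣-∣-triangle (2 ^ level u) (2 ^ level v) (2 ^ level w))
    (λ {u} {v} _ e → subst (∣ 2 ^ level u - 2 ^ level v ∣ ≤_) (sym (+-identityʳ (base u v))) (edge u v e)) p (everywhere p))
    where
    edge : ∀ u v → u ~ v → ∣ 2 ^ level u - 2 ^ level v ∣ ≤ base u v
    edge u v _ = subst (∣ 2 ^ level u - 2 ^ level v ∣ ≤_)
      (sym (mono-≤-distrib-⊔ (^-monoʳ-≤ 2) (level u) (level v))) (∣m-n∣≤m⊔n (2 ^ level u) (2 ^ level v))

  -- Climbing goes left to a multiple of 8 and then up, level by level.
  record Climb (u : Vertex) (j : ℕ) : Set where
    field
      {end}     : Vertex
      level-end : level end ≡ j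
      lower     : index end * 8 ^ j ≤ position u
      upper     : position u < suc (index end) * 8 ^ j
      walk      : Walk u end
      cost      : len walk ≤ 18 * unit j

  row-length : ∀ {i u v} (p : Star (InRow i) u v) → len (Star.map proj₁ p) ≤ steps p * (2 * unit i)
  row-length ε = z≤n
  row-length {i} (_◅_ {u} {v} (_ , lu , lv) p) = +-mono-≤ (≤-trans (weight-upper u v)
    (≤-reflexive (cong (λ l → 2 * unit l) (trans (cong₂ _⊔_ lu lv) (⊔-idem i))))) (row-length p)

  row-walk : ∀ {i u v} → level u ≡ i → level v ≡ i →
    Σ (Walk u v) λ p → len p ≤ ∣ index u - index v ∣ * (2 * unit i)
  row-walk {i} {u} {v} lu lv with ≤-total (index u) (index v)
  ... | inj₁ u≤v = let p , eq = row-right (index v ∸ index u) lu lv (sym (m∸n+n≡m u≤v)) in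
    Star.map proj₁ p , ≤-trans (row-length p) (≤-reflexive (cong (_* (2 * unit i)) (trans eq (sym (m≤n⇒∣m-n∣≡n∸m u≤v)))))
  ... | inj₂ v≤u = let p , eq = row-right (index u ∸ index v) lv lu (sym (m∸n+n≡m v≤u)) in
    reverse (Star.map proj₁ p) , ≤-trans (≤-reflexive (len-reverse (Star.map proj₁ p)))
      (≤-trans (row-length p) (≤-reflexive (cong (_* (2 * unit i)) (trans eq (sym (m≤n⇒∣n-m∣≡n∸m v≤u))))))

  climb : ∀ t u → level u + t ≤ n → Climb u (level u + t)
  climb zero u _ rewrite +-identityʳ (level u) = record
    { level-end = refl ; lower = ≤-refl
    ; upper = m<n+m (position u) (m^n>0 8 (level u)) ; walk = ε ; cost = z≤n }
  climb (suc t) u l≤n rewrite +-suc (level u) t = record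
    { level-end = lw
    ; lower     = ≤-trans (≤-trans (≤-reflexive (trans (cong (_* 8 ^ suc j) iw) (regroup q (8 ^ j))))
                                   (*-monoˡ-≤ (8 ^ j) q*8≤e)) (Climb.lower c)
    ; upper     = ≤-trans (Climb.upper c) (≤-trans (*-monoˡ-≤ (8 ^ j) e<[q+1]*8)
                    (≤-reflexive (trans (sym (regroup (suc q) (8 ^ j))) (cong (λ z → suc z * 8 ^ suc j) (sym iw)))))
    ; walk      = Climb.walk c ◅◅ (proj₁ row ◅◅ (rise ◅ ε))
    ; cost      = total-cost
    }
    where
    j : ℕ
    j = level u + t
    j≤n : j ≤ n
    j≤n = ≤-trans (n≤1+n j) l≤n
    c : Climb u j
    c = climb t u j≤n
    e : Vertex
    e = Climb.end c
    q : ℕ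
    q = index e / 8
    e≡ : index e ≡ index e % 8 + q * 8
    e≡ = m≡m%n+[m/n]*n (index e) 8
    q*8≤e : q * 8 ≤ index e
    q*8≤e = subst (q * 8 ≤_) (sym e≡) (m≤n+m (q * 8) (index e % 8))
    e<[q+1]*8 : suc (index e) ≤ suc q * 8
    e<[q+1]*8 = subst (λ z → suc z ≤ suc q * 8) (sym e≡) (+-monoˡ-≤ (q * 8) (m%n<n (index e) 8))
    regroup : ∀ q x → q * (8 * x) ≡ q * 8 * x
    regroup = solve-∀
    corner : ∃[ y ] level y ≡ j × index y ≡ q * 8
    corner = vertex-at j (q * 8) j≤n
      (≤-<-trans (≤-trans (*-monoˡ-≤ (8 ^ j) q*8≤e) (Climb.lower c)) (position-< u))
    y : Vertex
    y = proj₁ corner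
    ly : level y ≡ j
    ly = proj₁ (proj₂ corner)
    iy : index y ≡ q * 8
    iy = proj₂ (proj₂ corner)
    top : ∃[ w ] level w ≡ suc j × index w ≡ q
    top = vertex-at (suc j) q l≤n
      (≤-<-trans (≤-trans (≤-reflexive (regroup q (8 ^ j))) (≤-trans (*-monoˡ-≤ (8 ^ j) q*8≤e) (Climb.lower c)))
                 (position-< u))
    w : Vertex
    w = proj₁ top
    lw : level w ≡ suc j
    lw = proj₁ (proj₂ top)
    iw : index w ≡ q
    iw = proj₂ (proj₂ top)
    row : Σ (Walk e y) λ p → len p ≤ ∣ index e - index y ∣ * (2 * unit j)
    row = row-walk (Climb.level-end c) ly
    rise : y ~ w
    rise = up (trans (cong suc ly) (sym lw)) (trans iy (trans (*-comm q 8) (cong (8 *_) (sym iw))))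
    distance≤7 : ∣ index e - index y ∣ ≤ 7
    distance≤7 = subst (_≤ 7) (sym (trans (cong₂ ∣_-_∣ (trans e≡ (+-comm (index e % 8) (q * 8))) iy)
      (trans (∣-∣-comm (q * 8 + index e % 8) (q * 8)) (∣m-m+n∣≡n (q * 8) (index e % 8))))) (≤-pred (m%n<n (index e) 8))
    rise-cost : weight y w ≤ 2 * (2 * unit j)
    rise-cost = ≤-trans (weight-upper y w) (≤-reflexive (cong (2 *_) (trans
      (cong unit (trans (cong₂ _⊔_ ly lw) (m≤n⇒m⊔n≡n (n≤1+n j)))) (unit-suc j))))
    -- The origin of 18. With a the old unit, one more level costs at most seven row edges of length
    -- 2a and a rise of length 4a, so a bound of x units is preserved when x + 18 = 2x.
    sum : ∀ a → 18 * a + (7 * (2 * a) + (2 * (2 * a) + 0)) ≡ 18 * (2 * a)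
    sum = solve-∀
    total-cost : len (Climb.walk c ◅◅ (proj₁ row ◅◅ (rise ◅ ε))) ≤ 18 * unit (suc j)
    total-cost = begin
      len (Climb.walk c ◅◅ (proj₁ row ◅◅ (rise ◅ ε)))
        ≡⟨ trans (len-◅◅ (Climb.walk c) _) (cong (len (Climb.walk c) +_) (len-◅◅ (proj₁ row) (rise ◅ ε))) ⟩
      len (Climb.walk c) + (len (proj₁ row) + (weight y w + 0))
        ≤⟨ +-mono-≤ (Climb.cost c) (+-mono-≤ (≤-trans (proj₂ row) (*-monoˡ-≤ (2 * unit j) distance≤7))
                                             (+-monoˡ-≤ 0 rise-cost)) ⟩
      18 * unit j + (7 * (2 * unit j) + (2 * (2 * unit j) + 0)) ≡⟨ sum (unit j) ⟩
      18 * (2 * unit j)                                         ≡⟨ cong (18 *_) (sym (unit-suc j)) ⟩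
      18 * unit (suc j) ∎
      where open ≤-Reasoning

  climb-to : ∀ j u → level u ≤ j → j ≤ n → Climb u j
  climb-to j u u≤j j≤n = subst (Climb u) (m+[n∸m]≡n u≤j)
    (climb (j ∸ level u) u (subst (_≤ n) (sym (m+[n∸m]≡n u≤j)) j≤n))

  detour : ∀ {j u v} (c : Climb u j) (c′ : Climb v j) → Σ (Walk u v) λ q →
    len q ≤ 36 * unit j + ∣ index (Climb.end c) - index (Climb.end c′) ∣ * (2 * unit j)
  detour {j} c c′ = Climb.walk c ◅◅ (proj₁ row ◅◅ reverse (Climb.walk c′)) , (begin
    len (Climb.walk c ◅◅ (proj₁ row ◅◅ reverse (Climb.walk c′)))
      ≡⟨ trans (len-◅◅ (Climb.walk c) _) (cong (len (Climb.walk c) +_)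
           (trans (len-◅◅ (proj₁ row) _) (cong (len (proj₁ row) +_) (len-reverse (Climb.walk c′))))) ⟩
    len (Climb.walk c) + (len (proj₁ row) + len (Climb.walk c′))
      ≤⟨ +-mono-≤ (Climb.cost c) (+-mono-≤ (proj₂ row) (Climb.cost c′)) ⟩
    18 * unit j + (r + 18 * unit j)   ≡⟨ regroup (unit j) r ⟩
    36 * unit j + r ∎)
    where
    open ≤-Reasoning
    row : Σ (Walk (Climb.end c) (Climb.end c′)) λ p →
      len p ≤ ∣ index (Climb.end c) - index (Climb.end c′) ∣ * (2 * unit j)
    row = row-walk (Climb.level-end c) (Climb.level-end c′)
    r : ℕ
    r = ∣ index (Climb.end c) - index (Climb.end c′) ∣ * (2 * unit j)
    regroup : ∀ a r → 18 * a + (r + 18 * a) ≡ 36 * a + r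
    regroup = solve-∀

  -- Between points of cells `a` and `b` of width `e` lie the b - a - 1 full cells strictly in
  -- between.
  cells : ∀ {a b e x y} → a ≤ b → b * e ≤ y → x ≤ suc a * e → ∣ a - b ∣ * e ≤ ∣ x - y ∣ + e
  cells {a} {b} {e} {x} {y} a≤b be≤y x≤ = +-cancelˡ-≤ (a * e) _ _ (begin
    a * e + ∣ a - b ∣ * e       ≡⟨ cong (λ z → a * e + z * e) (m≤n⇒∣m-n∣≡n∸m a≤b) ⟩
    a * e + (b ∸ a) * e         ≡⟨ sym (*-distribʳ-+ e a (b ∸ a)) ⟩
    (a + (b ∸ a)) * e           ≡⟨ cong (_* e) (m+[n∸m]≡n a≤b) ⟩
    b * e                       ≤⟨ be≤y ⟩
    y                           ≤⟨ m≤n+∣m-n∣ y x ⟩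
    x + ∣ y - x ∣               ≡⟨ cong (x +_) (∣-∣-comm y x) ⟩
    x + ∣ x - y ∣               ≤⟨ +-monoˡ-≤ ∣ x - y ∣ x≤ ⟩
    e + a * e + ∣ x - y ∣       ≡⟨ regroup e (a * e) ∣ x - y ∣ ⟩
    a * e + (∣ x - y ∣ + e) ∎)
    where
    open ≤-Reasoning
    regroup : ∀ e a d → e + a + d ≡ a + (d + e)
    regroup = solve-∀

  climb-cells : ∀ {j u v} (c : Climb u j) (c′ : Climb v j) →
    ∣ index (Climb.end c) - index (Climb.end c′) ∣ * 8 ^ j ≤ ∣ position u - position v ∣ + 8 ^ j
  climb-cells {j} {u} {v} c c′ with ≤-total (index (Climb.end c)) (index (Climb.end c′))
  ... | inj₁ a≤b = cells a≤b (Climb.lower c′) (<⇒≤ (Climb.upper c))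
  ... | inj₂ b≤a = subst₂ (λ x y → x * 8 ^ j ≤ y + 8 ^ j)
    (∣-∣-comm (index (Climb.end c′)) (index (Climb.end c))) (∣-∣-comm (position v) (position u))
    (cells b≤a (Climb.lower c) (<⇒≤ (Climb.upper c′)))

  top-index : ∀ {u} (c : Climb u n) → index (Climb.end c) ≡ 0
  top-index {u} c = n<1⇒n≡0 (*-cancelʳ-< (8 ^ n) (index (Climb.end c)) 1
    (≤-<-trans (Climb.lower c) (subst (position u <_) (sym (*-identityˡ (8 ^ n))) (position-< u))))

  -- A walk below level i + 1 is slow: it needs length about 4 units of
  -- level i + 1 per step of that level, which going up and across does not.
  low-shortest : ∀ i {u v} (p : Walk u v) → Shortest p → All (λ x → level x ≤ i) (vertices p) →
    len p ≤ 76 * unit (suc i)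
  low-shortest i {u} {v} p shortest low with suc i ≤? n
  -- There is no level i + 1. The top level `n` has a single node, so both climbs end there and the
  -- detour needs no row walk.
  ... | no i≮n = begin
    len p                     ≤⟨ shortest (proj₁ (detour c c′)) ⟩
    len (proj₁ (detour c c′)) ≤⟨ proj₂ (detour c c′) ⟩
    36 * unit n + ∣ index (Climb.end c) - index (Climb.end c′) ∣ * (2 * unit n)
      ≡⟨ cong (λ z → 36 * unit n + z * (2 * unit n)) (cong₂ ∣_-_∣ (top-index c) (top-index c′)) ⟩
    36 * unit n + 0           ≡⟨ +-identityʳ (36 * unit n) ⟩
    36 * unit n               ≤⟨ *-mono-≤ (m≤m+n 36 40) (unit-mono (<⇒≤ (≰⇒> i≮n))) ⟩
    76 * unit (suc i) ∎
    where
    open ≤-Reasoning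
    c : Climb u n
    c = climb-to n u (level-≤ u) ≤-refl
    c′ : Climb v n
    c′ = climb-to n v (level-≤ v) ≤-refl
  -- Twice the detour bound gives 2 len ≤ 72A + 4ΔA, and slowness gives 4ΔA ≤ len + 4A; cancelling
  -- one len yields 76A. The slow rate 4 has to exceed the detour rate 2 for this.
  ... | yes i<n = +-cancelˡ-≤ (len p) _ _ (begin
    len p + len p                       ≤⟨ +-mono-≤ upper upper ⟩
    (36 * A + Δ * (2 * A)) + (36 * A + Δ * (2 * A)) ≡⟨ regroup₁ A Δ ⟩
    72 * A + Δ * (4 * A)                ≤⟨ +-monoʳ-≤ (72 * A) slow ⟩
    72 * A + (len p + 4 * A)            ≡⟨ regroup₂ A (len p) ⟩
    len p + 76 * A ∎)
    where
    open ≤-Reasoning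
    c : Climb u (suc i)
    c = climb-to (suc i) u (m≤n⇒m≤1+n (All.lookup low (start∈ p))) i<n
    c′ : Climb v (suc i)
    c′ = climb-to (suc i) v (m≤n⇒m≤1+n (All.lookup low (end∈ p))) i<n
    A Δ X : ℕ
    A = unit (suc i)
    Δ = ∣ index (Climb.end c) - index (Climb.end c′) ∣
    X = ∣ position u - position v ∣
    upper : len p ≤ 36 * A + Δ * (2 * A)
    upper = ≤-trans (shortest (proj₁ (detour c c′))) (proj₂ (detour c c′))
    regroup₁ : ∀ a d → (36 * a + d * (2 * a)) + (36 * a + d * (2 * a)) ≡ 72 * a + d * (4 * a)
    regroup₁ = solve-∀
    regroup₂ : ∀ a l → 72 * a + (l + 4 * a) ≡ l + 76 * a
    regroup₂ = solve-∀
    regroup₃ : ∀ f t d m → f * (d * (4 * (2 * t * m))) ≡ d * (8 * (f * t)) * m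
    regroup₃ = solve-∀
    regroup₄ : ∀ f t m → f * (4 * (2 * t * m)) ≡ 8 * (f * t) * m
    regroup₄ = solve-∀
    slow : Δ * (4 * A) ≤ len p + 4 * A
    slow = *-cancelˡ-≤ (4 ^ i) {{m^n≢0 4 i}} (begin
      4 ^ i * (Δ * (4 * A))                 ≡⟨ regroup₃ (4 ^ i) (2 ^ i) Δ scale ⟩
      Δ * (8 * (4 ^ i * 2 ^ i)) * scale     ≡⟨ cong (λ z → Δ * (8 * z) * scale) (sym (8^≡4^*2^ i)) ⟩
      Δ * 8 ^ suc i * scale                 ≤⟨ *-monoˡ-≤ scale (climb-cells c c′) ⟩
      (X + 8 ^ suc i) * scale               ≡⟨ *-distribʳ-+ scale X (8 ^ suc i) ⟩
      X * scale + 8 * 8 ^ i * scale         ≤⟨ +-monoˡ-≤ (8 * 8 ^ i * scale) (position-bound-below i p low) ⟩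
      4 ^ i * len p + 8 * 8 ^ i * scale     ≡⟨ cong (λ z → 4 ^ i * len p + 8 * z * scale) (8^≡4^*2^ i) ⟩
      4 ^ i * len p + 8 * (4 ^ i * 2 ^ i) * scale
        ≡⟨ cong (4 ^ i * len p +_) (sym (regroup₄ (4 ^ i) (2 ^ i) scale)) ⟩
      4 ^ i * len p + 4 ^ i * (4 * A)       ≡⟨ sym (*-distribˡ-+ (4 ^ i) (len p) (4 * A)) ⟩
      4 ^ i * (len p + 4 * A) ∎)

  -- If b ≥ a + 11 and a ≥ i, then 2^b - 2^a ≥ 2^(a+11) - 2^a ≥ 2^(i+10), which `level-bound`
  -- forbids.
  level-close : ∀ {i u v} (p : Walk u v) → len p < unit (i + 10) → i ≤ level u → i ≤ level v →
    ∣ level u - level v ∣ < 11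
  level-close {i} {u} {v} p short i≤u i≤v = ≰⇒> λ far → <⇒≱ short (begin
    2 ^ (i + 10) * scale                    ≤⟨ *-monoˡ-≤ scale (separated far) ⟩
    ∣ 2 ^ level u - 2 ^ level v ∣ * scale   ≤⟨ level-bound p ⟩
    len p ∎)
    where
    open ≤-Reasoning
    gap : ∀ {a b} → i ≤ a → a + 11 ≤ b → 2 ^ (i + 10) ≤ 2 ^ b ∸ 2 ^ a
    gap {a} {b} i≤a a+11≤b = m+n≤o⇒m≤o∸n (2 ^ (i + 10)) (begin
      2 ^ (i + 10) + 2 ^ a            ≤⟨ +-mono-≤ (^-monoʳ-≤ 2 (+-monoˡ-≤ 10 i≤a)) (^-monoʳ-≤ 2 (m≤m+n a 10)) ⟩
      2 ^ (a + 10) + 2 ^ (a + 10)     ≡⟨ cong (2 ^ (a + 10) +_) (sym (+-identityʳ _)) ⟩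
      2 ^ suc (a + 10)                ≡⟨ cong (2 ^_) (sym (+-suc a 10)) ⟩
      2 ^ (a + 11)                    ≤⟨ ^-monoʳ-≤ 2 a+11≤b ⟩
      2 ^ b ∎)
    separated : 11 ≤ ∣ level u - level v ∣ → 2 ^ (i + 10) ≤ ∣ 2 ^ level u - 2 ^ level v ∣
    separated far with ≤-total (level u) (level v)
    ... | inj₁ u≤v = subst (2 ^ (i + 10) ≤_) (sym (m≤n⇒∣m-n∣≡n∸m (^-monoʳ-≤ 2 u≤v)))
      (gap i≤u (≤-trans (+-monoʳ-≤ (level u) (subst (11 ≤_) (m≤n⇒∣m-n∣≡n∸m u≤v) far)) (≤-reflexive (m+[n∸m]≡n u≤v))))
    ... | inj₂ v≤u = subst (2 ^ (i + 10) ≤_) (sym (m≤n⇒∣n-m∣≡n∸m (^-monoʳ-≤ 2 v≤u)))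
      (gap i≤v (≤-trans (+-monoʳ-≤ (level v) (subst (11 ≤_) (m≤n⇒∣n-m∣≡n∸m v≤u) far)) (≤-reflexive (m+[n∸m]≡n v≤u))))

  -- An index difference of 8^10 would reach the cap of `position-bound` ten levels up, and reaching
  -- the cap 8^J at rate 4^J costs 2^J units of `scale`.
  index-close : ∀ {u v} (p : Walk u v) → len p < unit (level u + 10) → level u ≡ level v →
    ∣ index u - index v ∣ < 8 ^ 10
  index-close {u} {v} p short same = ≰⇒> λ far → <⇒≱ short
    (*-cancelˡ-≤ (4 ^ top) {{m^n≢0 4 top}} (begin
      4 ^ top * (2 ^ top * scale)                           ≡⟨ sym (*-assoc (4 ^ top) (2 ^ top) scale) ⟩
      4 ^ top * 2 ^ top * scale                             ≡⟨ cong (_* scale) (sym (8^≡4^*2^ top)) ⟩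
      8 ^ top * scale                                     ≡⟨ cong (_* scale) (sym (m≥n⇒m⊓n≡n (8^top≤ far))) ⟩
      (∣ position u - position v ∣ ⊓ 8 ^ top) * scale     ≤⟨ position-bound top p ⟩
      4 ^ top * len p ∎))
    where
    open ≤-Reasoning
    top : ℕ
    top = level u + 10
    8^top≤ : 8 ^ 10 ≤ ∣ index u - index v ∣ → 8 ^ top ≤ ∣ position u - position v ∣
    8^top≤ far = begin
      8 ^ top                                         ≡⟨ cong (8 ^_) (+-comm (level u) 10) ⟩
      8 ^ (10 + level u)                            ≡⟨ ^-distribˡ-+-* 8 10 (level u) ⟩
      8 ^ 10 * 8 ^ level u                          ≤⟨ *-monoˡ-≤ (8 ^ level u) far ⟩
      ∣ index u - index v ∣ * 8 ^ level u           ≡⟨ *-distribʳ-∣-∣ (8 ^ level u) (index u) (index v) ⟩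
      ∣ position u - index v * 8 ^ level u ∣        ≡⟨ cong (λ l → ∣ position u - index v * 8 ^ l ∣) same ⟩
      ∣ position u - position v ∣ ∎

  opaque
    unfolding window

    residues : Vertex → Fin window
    residues z = combine (level z mod 11) (index z mod (8 ^ 10))

    residues-injective : ∀ {i u v} (p : Walk u v) → len p < unit (i + 10) → i ≤ level u → i ≤ level v →
      residues u ≡ residues v → u ≡ v
    residues-injective {i} {u} {v} p short i≤u i≤v eq = vertex-≡ same-level
      (mod-injective (proj₂ eqs) (index-close p (<-≤-trans short (unit-mono (+-monoˡ-≤ 10 i≤u))) same-level))
      where
      eqs : level u mod 11 ≡ level v mod 11 × index u mod (8 ^ 10) ≡ index v mod (8 ^ 10)
      eqs = Fin.combine-injective (level u mod 11) (index u mod (8 ^ 10)) (level v mod 11) (index v mod (8 ^ 10)) eq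
      same-level : level u ≡ level v
      same-level = mod-injective (proj₁ eqs) (level-close p short i≤u i≤v)

  -- A node has at most one neighbour in each direction, so an edge is determined by its tail and
  -- one of four values.
  direction : ∀ {i k j l} → Step i k j l → Fin 4
  direction (right _ _) = zero
  direction (left _ _)  = suc zero
  direction (up _ _)    = suc (suc zero)
  direction (down _ _)  = suc (suc (suc zero))

  direction-injective : ∀ {i k j l j′ l′} (e : Step i k j l) (e′ : Step i k j′ l′) →
    direction e ≡ direction e′ → j ≡ j′ × l ≡ l′
  direction-injective (right p q) (right p′ q′) _ = trans (sym p) p′ , trans (sym q) q′
  direction-injective (left p q)  (left p′ q′)  _ = trans (sym p) p′ , suc-injective (trans (sym q) q′)
  direction-injective (up p q)    (up p′ q′)    _ = trans (sym p) p′ , *-cancelˡ-≡ _ _ 8 (trans (sym q) q′)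
  direction-injective (down p q)  (down p′ q′)  _ = suc-injective (trans (sym p) p′) , trans (sym q) q′

  same-neighbour : ∀ {u v u′ v′} (e : u ~ v) (e′ : u′ ~ v′) → u ≡ u′ → direction e ≡ direction e′ → v ≡ v′
  same-neighbour e e′ refl eq = let p , q = direction-injective e e′ eq in vertex-≡ p q

  level-step : ∀ {i k j l} → Step i k j l → j ≤ suc i
  level-step (right refl _) = n≤1+n _
  level-step (left refl _)  = n≤1+n _
  level-step (up refl _)    = ≤-refl
  level-step (down refl _)  = ≤-trans (n≤1+n _) (n≤1+n _)

  weight-from-low : ∀ {i u v} → level u < i → u ~ v → weight u v ≤ 2 * unit i
  weight-from-low {i} {u} {v} u<i e = ≤-trans (weight-upper u v)
    (*-monoʳ-≤ 2 (unit-mono (⊔-lub (<⇒≤ u<i) (≤-trans (level-step e) u<i))))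

  -- Cuts of skip lists

  module CutSize (s : Vertex) (path : ∀ v → Σ (Walk s v) (WeightedGraph.IsShortest weighted)) where

    open SkeletonTree weighted s path
    open WalkLength _~_ (λ {u} {v} _ → ℓ u v) using (walkLength-◅◅)
    open T using (Point; node; inner; Parent; Cut)
    open WeightedGraph weighted using (walkLength; IsShortest)

    parent-walk : ∀ {a b} → Star Parent a b → Walk a b
    parent-walk = Star.map (λ (_ , e , _) → e)

    d-chain : ∀ {a b} (c : Star Parent a b) → d b ≡ d a ℚ.+ walkLength (parent-walk c)
    d-chain {a} ε = sym (ℚ.+-identityʳ (d a))
    d-chain {a} {b} (_◅_ {j = y} pa c) = begin
      d b                                             ≡⟨ d-chain c ⟩
      d y ℚ.+ walkLength (parent-walk c)              ≡⟨ cong (ℚ._+ walkLength (parent-walk c)) (d-parent pa) ⟩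
      d a ℚ.+ ℓ a y ℚ.+ walkLength (parent-walk c)    ≡⟨ ℚ.+-assoc (d a) (ℓ a y) (walkLength (parent-walk c)) ⟩
      d a ℚ.+ (ℓ a y ℚ.+ walkLength (parent-walk c)) ∎
      where open ≡-Reasoning

    parent-walk-shortest : ∀ {a b} (c : Star Parent a b) → IsShortest (parent-walk c)
    parent-walk-shortest {a} {b} c q = ℚ-cancelˡ-≤ (d a) (begin
      d a ℚ.+ walkLength (parent-walk c)  ≡⟨ sym (d-chain c) ⟩
      d b                                 ≤⟨ proj₂ (path b) (proj₁ (path a) ◅◅ q) ⟩
      walkLength (proj₁ (path a) ◅◅ q)    ≡⟨ walkLength-◅◅ (proj₁ (path a)) q ⟩
      d a ℚ.+ walkLength q ∎)
      where open ℚ.≤-Reasoning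

    Low : ℕ → ∀ {a b} → Star Parent a b → Set
    Low i c = All (λ x → level x < i) (vertices c)

    low-chain : ∀ {i a b} (c : Star Parent a b) → Low i c → d b ℚ.≤ d a ℚ.+ fromℕ (76 * unit i)
    low-chain {zero} c low = contradiction (All.lookup low (start∈ c)) λ ()
    low-chain {suc i} {a} {b} c low = begin
      d b                                      ≡⟨ d-chain c ⟩
      d a ℚ.+ walkLength (parent-walk c)       ≡⟨ cong (d a ℚ.+_) (walkLength-len (parent-walk c)) ⟩
      d a ℚ.+ fromℕ (len (parent-walk c))      ≤⟨ ℚ.+-monoʳ-≤ (d a) (fromℕ-mono-≤ (low-shortest i (parent-walk c)
        (shortest (parent-walk c) (parent-walk-shortest c))
        (All.map ≤-pred (subst (All _) (sym (vertices-map (λ (_ , e , _) → e) c)) low)))) ⟩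
      d a ℚ.+ fromℕ (76 * unit (suc i)) ∎
      where open ℚ.≤-Reasoning

    -- The step into the first node of level at least `i` is kept apart, because `low-chain` bounds
    -- only chains all of whose nodes are low.
    data Scan (i : ℕ) (a b : Vertex) : Set where
      stays-low : (c : Star Parent a b) → Low i c → Scan i a b
      meets     : ∀ {y z} (c : Star Parent a y) → Low i c → Parent y z → i ≤ level z → Scan i a b

    scan : ∀ {i a b} → level a < i → Star Parent a b → Scan i a b
    scan low ε = stays-low ε (low ∷ [])
    scan {i} low (_◅_ {j = y} pa c) with i ≤? level y
    ... | yes high = meets ε (low ∷ []) pa high
    ... | no  ¬high with scan (≰⇒> ¬high) c
    ...   | stays-low c′ lows     = stays-low (pa ◅ c′) (low ∷ lows)
    ...   | meets c′ lows pz high = meets (pa ◅ c′) (low ∷ lows) pz high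

    -- A path below the cut staying in levels < i gains at most 78 units of
    -- level i; this is less than r / 2 because r > 160 units if i > 0.
    module _ (r : ℚ) (i : ℕ) (r≤ : r ℚ.≤ fromℕ (320 * unit i))
      (i-minimal : ∀ j → i ≡ suc j → fromℕ (320 * unit j) ℚ.< r) where

      -- 400 = 320 + 80: the radius is at most 320 units, and the node assigned to a cut point lies
      -- at most 80 units beyond, namely 2 for the edge carrying the point, 76 for a low chain and 2
      -- for the edge into the node.
      Near : Vertex → Set
      Near z = d z ℚ.≤ fromℕ (400 * unit i)

      -- A point of the cut lies above a nearby node z of level ≥ i, which then
      -- determines it, or inside an edge leaving such a node.
      data Class (x : Point) : Set where
        under   : ∀ z → i ≤ level z → Near z → Star Parent (below x) z → Class x
        leaving : ∀ u v α → x ≡ inner u v α → u ~ v → i ≤ level u → Near u → Class x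

      near : ∀ {z} k → k ≤ 80 → d z ℚ.≤ r ℚ.+ fromℕ (k * unit i) → Near z
      near {z} k k≤80 d≤ = begin
        d z                                             ≤⟨ d≤ ⟩
        r ℚ.+ fromℕ (k * unit i)                        ≤⟨ ℚ.+-mono-≤ r≤ (fromℕ-mono-≤ (*-monoˡ-≤ (unit i) k≤80)) ⟩
        fromℕ (320 * unit i) ℚ.+ fromℕ (80 * unit i)    ≡⟨ sym (fromℕ-+ (320 * unit i) (80 * unit i)) ⟩
        fromℕ (320 * unit i + 80 * unit i)              ≡⟨ cong fromℕ (sym (*-distribʳ-+ (unit i) 320 80)) ⟩
        fromℕ (400 * unit i) ∎
        where open ℚ.≤-Reasoning

      extend : ∀ {y k m} {a : ℚ} → y ℚ.≤ r ℚ.+ fromℕ (k * unit i) → a ℚ.≤ y ℚ.+ fromℕ (m * unit i) →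
        a ℚ.≤ r ℚ.+ fromℕ ((k + m) * unit i)
      extend {y} {k} {m} {a} y≤ a≤ = begin
        a                                                     ≤⟨ a≤ ⟩
        y ℚ.+ fromℕ (m * unit i)                              ≤⟨ ℚ.+-monoˡ-≤ _ y≤ ⟩
        r ℚ.+ fromℕ (k * unit i) ℚ.+ fromℕ (m * unit i)       ≡⟨ ℚ.+-assoc r _ _ ⟩
        r ℚ.+ (fromℕ (k * unit i) ℚ.+ fromℕ (m * unit i))     ≡⟨ cong (r ℚ.+_) (sym (fromℕ-+ (k * unit i) (m * unit i))) ⟩
        r ℚ.+ fromℕ (k * unit i + m * unit i)                 ≡⟨ cong (λ z → r ℚ.+ fromℕ z) (sym (*-distribʳ-+ (unit i) k m)) ⟩
        r ℚ.+ fromℕ ((k + m) * unit i) ∎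
        where open ℚ.≤-Reasoning

      low-parent : ∀ {y z} → level y < i → Parent y z → d z ℚ.≤ d y ℚ.+ fromℕ (2 * unit i)
      low-parent {y} {z} low pz@(_ , e , _) = subst (ℚ._≤ d y ℚ.+ fromℕ (2 * unit i)) (sym (d-parent pz))
        (ℚ.+-monoʳ-≤ (d y) (fromℕ-mono-≤ (weight-from-low low e)))

      -- A node of level below `i` shows that `i` is positive, so minimality of `i` applies: with
      -- units of level i - 1, r exceeds 320, whereas twice 78 units of level `i` are only 312.
      half-≤ : ∀ {a} → level a < i → ¬ (½ ℚ.* r ℚ.≤ fromℕ (78 * unit i))
      half-≤ {a} low ½r≤ = below-level i refl low
        where
        below-level : ∀ k → i ≡ k → ¬ (level a < k)
        below-level (suc j) refl _ = ℚ.<-irrefl refl (begin-strict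
          r                                 ≡⟨ sym (ℚ.*-identityˡ r) ⟩
          (½ ℚ.+ ½) ℚ.* r                   ≡⟨ ℚ.*-distribʳ-+ r ½ ½ ⟩
          ½ ℚ.* r ℚ.+ ½ ℚ.* r               ≤⟨ ℚ.+-mono-≤ ½r≤ ½r≤ ⟩
          fromℕ (78 * unit i) ℚ.+ fromℕ (78 * unit i) ≡⟨ sym (fromℕ-+ (78 * unit i) (78 * unit i)) ⟩
          fromℕ (78 * unit i + 78 * unit i) ≤⟨ fromℕ-mono-≤ bound ⟩
          fromℕ (320 * unit j)              <⟨ i-minimal j refl ⟩
          r ∎)
          where
          open ℚ.≤-Reasoning
          regroup : ∀ a → 78 * (2 * a) + 78 * (2 * a) ≡ 312 * a
          regroup = solve-∀
          bound : 78 * unit (suc j) + 78 * unit (suc j) ≤ 320 * unit j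
          bound = ≤-trans (≤-reflexive (trans (cong (λ z → 78 * z + 78 * z) (unit-suc j)) (regroup (unit j))))
            (*-monoˡ-≤ (unit j) (m≤m+n 312 8))

      -- The slack of 2 units covers a cut point inside an edge whose tail is low; for a node,
      -- `below` is at depth `r` itself.
      classify-below : ∀ {x} (cp : CutPoint r x) → d (below x) ℚ.≤ r ℚ.+ fromℕ (2 * unit i) → Class x
      classify-below {x} cp d≤ = by-level (i ≤? level (below x))
        where
        by-scan : level (below x) < i → Scan i (below x) (below (CutPoint.w cp)) → Class x
        by-scan low (meets {z = z} c lows pz high) = under z high
          (near 80 ≤-refl (extend {k = 78} {2} (extend {k = 2} {76} d≤ (low-chain c lows))
                                                (low-parent (All.lookup lows (end∈ c)) pz)))
          (c ◅◅ (pz ◅ ε))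
        -- The depth of `w` would be at least r + r/2 and at most r plus 78 units.
        by-scan low (stays-low c lows) = contradiction
          (ℚ-cancelˡ-≤ r (ℚ.≤-trans (CutPoint.far cp) (ℚ.≤-trans (depth-≤-below (CutPoint.valid-w cp))
            (extend {k = 2} {76} d≤ (low-chain c lows)))))
          (half-≤ {below x} low)

        by-level : Dec (i ≤ level (below x)) → Class x
        by-level (yes high) = under (below x) high (near 2 (m≤m+n 2 78) d≤) ε
        by-level (no ¬high) = by-scan (≰⇒> ¬high) (scan (≰⇒> ¬high) (CutPoint.chain cp))

      -- An edge with a tail of high level may be far longer than a unit of level `i`, so its lower
      -- end need not be near. Its points are therefore charged to the tail, which lies above the
      -- cut.
      classify : ∀ {x} → CutPoint r x → Class x
      classify {node v} cp = classify-below cp (ℚ.≤-trans (ℚ.≤-reflexive (CutPoint.at-depth cp))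
        (p≤p+q r (fromℕ-nonneg (2 * unit i))))
      classify {inner u v α} cp = by-level (CutPoint.valid cp) (i ≤? level u)
        where
        d≤r : 0ℚ ℚ.< α → d u ℚ.≤ r
        d≤r 0<α = ℚ.≤-trans (p≤p+q (d u) (ℚ.<⇒≤ 0<α)) (ℚ.≤-reflexive (CutPoint.at-depth cp))

        by-level : Valid (inner u v α) → Dec (i ≤ level u) → Class (inner u v α)
        by-level ((_ , e , _) , 0<α , _) (yes high) =
          leaving u v α refl e high (near 0 z≤n (ℚ.≤-trans (d≤r 0<α) (p≤p+q r (fromℕ-nonneg 0))))
        by-level (pa , 0<α , _) (no ¬high) = classify-below cp
          (ℚ.≤-trans (low-parent (≰⇒> ¬high) pa) (ℚ.+-monoˡ-≤ (fromℕ (2 * unit i)) (d≤r 0<α)))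

      -- One tag for `under` and four for the direction of the edge. The offset inside an edge need
      -- not be recorded, as the depth `r` fixes it.
      code : ∀ {x} → Class x → Fin (5 * window)
      code (under z _ _ _)           = combine (zero {4}) (residues z)
      code (leaving u _ _ _ e _ _) = combine (suc (direction e)) (residues u)

      near-≡ : ∀ {u v} → Near u → Near v → i ≤ level u → i ≤ level v → residues u ≡ residues v → u ≡ v
      near-≡ {u} {v} nu nv i≤u i≤v = residues-injective p p-short i≤u i≤v
        where
        p : Walk u v
        p = reverse (proj₁ (path u)) ◅◅ proj₁ (path v)
        near-len : ∀ {z} → Near z → len (proj₁ (path z)) ≤ 400 * unit i
        near-len {z} nz = fromℕ-cancel-≤ (subst (ℚ._≤ fromℕ (400 * unit i)) (walkLength-len (proj₁ (path z))) nz)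
        -- The walk through the root has at most 800 units, and 800 < 1024 = 2^10; this is why the
        -- residues are taken for ten levels.
        p-short : len p < unit (i + 10)
        p-short = begin-strict
          len p
            ≡⟨ trans (len-◅◅ (reverse (proj₁ (path u))) (proj₁ (path v)))
                     (cong (_+ len (proj₁ (path v))) (len-reverse (proj₁ (path u)))) ⟩
          len (proj₁ (path u)) + len (proj₁ (path v)) ≤⟨ +-mono-≤ (near-len nu) (near-len nv) ⟩
          400 * unit i + 400 * unit i                 ≡⟨ sym (*-distribʳ-+ (unit i) 400 400) ⟩
          800 * unit i
            <⟨ *-monoˡ-< (unit i) {{m*n≢0 (2 ^ i) scale {{m^n≢0 2 i}}}} {800} {1024} (m≤m+n 801 223) ⟩
          1024 * unit i                               ≡⟨ sym (unit-+ i 10) ⟩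
          unit (i + 10) ∎
          where open ≤-Reasoning

      inner-≡ : ∀ {u v α u′ v′ α′} → u ≡ u′ → v ≡ v′ → depth (inner u v α) ≡ depth (inner u′ v′ α′) →
        inner u v α ≡ inner u′ v′ α′
      inner-≡ refl refl = inner-determined

      code-injective : ∀ {x y} → CutPoint r x → CutPoint r y → (c : Class x) (c′ : Class y) →
        code c ≡ code c′ → x ≡ y
      code-injective {y = y} p q (under z high nz c) (under z′ high′ nz′ c′) eq =
        common-descendant (CutPoint.valid p) (CutPoint.valid q)
          (trans (CutPoint.at-depth p) (sym (CutPoint.at-depth q))) c (subst (Star Parent (below y)) (sym z≡z′) c′)
        where
        z≡z′ : z ≡ z′
        z≡z′ = near-≡ nz nz′ high high′ (proj₂ (Fin.combine-injective (zero {4}) (residues z) zero (residues z′) eq))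
      code-injective p q (leaving u v α refl e high nu) (leaving u′ v′ α′ refl e′ high′ nu′) eq =
        inner-≡ u≡u′ (same-neighbour e e′ u≡u′ (Fin.suc-injective (proj₁ eqs)))
          (trans (CutPoint.at-depth p) (sym (CutPoint.at-depth q)))
        where
        eqs : Fin.suc (direction e) ≡ suc (direction e′) × residues u ≡ residues u′
        eqs = Fin.combine-injective (suc (direction e)) (residues u) (suc (direction e′)) (residues u′) eq
        u≡u′ : u ≡ u′
        u≡u′ = near-≡ nu nu′ high high′ (proj₂ eqs)
      code-injective p q (under z _ _ _) (leaving u _ _ _ e _ _) eq =
        contradiction (proj₁ (Fin.combine-injective zero (residues z) (suc (direction e)) (residues u) eq)) λ ()
      code-injective p q (leaving u _ _ _ e _ _) (under z _ _ _) eq =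
        contradiction (proj₁ (Fin.combine-injective (suc (direction e)) (residues u) zero (residues z) eq)) λ ()

      size-≤ : ∀ {m} → HasCardinality (Cut r) m → m ≤ 5 * window
      size-≤ card = cardinality-≤ card (λ c → code (classify (cut-point c)))
        λ c c′ → code-injective (cut-point c) (cut-point c′) (classify (cut-point c)) (classify (cut-point c′))

    scale-of : ∀ r → ∃[ i ] r ℚ.≤ fromℕ (320 * unit i) × (∀ j → i ≡ suc j → ¬ (r ℚ.≤ fromℕ (320 * unit j)))
    scale-of r = let b , r≤b = ≤-fromℕ r in
      least (λ i → r ℚ.≤? fromℕ (320 * unit i)) b (ℚ.≤-trans r≤b (fromℕ-mono-≤ (below-unit b)))
      where
      below-unit : ∀ b → b ≤ 320 * unit b
      below-unit b = ≤-trans (<⇒≤ (n<2^n b)) (≤-trans (m≤m*n (2 ^ b) scale) (m≤m+n (unit b) (319 * unit b)))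

    cut-size-≤ : ∀ {r m} → HasCardinality (Cut r) m → m ≤ 5 * window
    cut-size-≤ {r} = let i , r≤ , minimal = scale-of r in size-≤ r i r≤ (λ j i≡ → ℚ.≰⇒> (minimal j i≡))

-- Grids in skip lists

module SkipListGrid (h : ℕ) where

  open SkipList (h + h)

  -- A row is a full level, a column the nodes above a multiple of 8^h, which is present on every
  -- level up to `h`. The total height h + h leaves 8^h nodes on level `h`, enough for h + 1
  -- columns.
  Row Col : Fin (suc h) → Vertex → Set
  Row i v = level v ≡ toℕ i
  Col c v = level v ≤ h × position v ≡ toℕ c * 8 ^ h

  8^h-nonZero : ℕ.NonZero (8 ^ h)
  8^h-nonZero = m^n≢0 8 h

  InCol : Fin (suc h) → Vertex → Vertex → Set
  InCol c a b = a ~ b × Col c a × Col c b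

  -- Below level `h` the index of a column node is a multiple of 8, so its edge upwards exists and
  -- keeps the position. A column is connected because all its nodes reach its one node of level
  -- `h`.
  to-top : ∀ c t {u} → level u + t ≡ h → position u ≡ toℕ c * 8 ^ h →
    ∃[ w ] level w ≡ h × index w ≡ toℕ c × Star (InCol c) u w
  to-top c zero {u} lu pu = u , l≡h , *-cancelʳ-≡ (index u) (toℕ c) (8 ^ h) {{8^h-nonZero}}
    (trans (cong (λ l → index u * 8 ^ l) (sym l≡h)) pu) , ε
    where
    l≡h : level u ≡ h
    l≡h = trans (sym (+-identityʳ (level u))) lu
  to-top c (suc t) {u} lu pu =
    let w , lw , iw , p = to-top c t {y} ly+t py
    in w , lw , iw , _◅_ {j = y}
         (up (sym ly) (trans index-u (cong (8 *_) (sym iy))) , (<⇒≤ l<h , pu) , (subst (_≤ h) (sym ly) l<h , py)) p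
    where
    l<h : suc (level u) ≤ h
    l<h = subst (suc (level u) ≤_) (trans (sym (+-suc (level u) t)) lu) (m≤m+n (suc (level u)) t)
    regroup : ∀ c e f → c * (f * (8 * e)) ≡ 8 * (c * e) * f
    regroup = solve-∀
    regroup′ : ∀ q f → q * (8 * f) ≡ 8 * q * f
    regroup′ = solve-∀
    index-u : index u ≡ 8 * (toℕ c * 8 ^ t)
    index-u = *-cancelʳ-≡ (index u) (8 * (toℕ c * 8 ^ t)) (8 ^ level u) {{m^n≢0 8 (level u)}} (begin
      position u                            ≡⟨ pu ⟩
      toℕ c * 8 ^ h                         ≡⟨ cong (λ l → toℕ c * 8 ^ l) (sym lu) ⟩
      toℕ c * 8 ^ (level u + suc t)         ≡⟨ cong (toℕ c *_) (^-distribˡ-+-* 8 (level u) (suc t)) ⟩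
      toℕ c * (8 ^ level u * (8 * 8 ^ t))   ≡⟨ regroup (toℕ c) (8 ^ t) (8 ^ level u) ⟩
      8 * (toℕ c * 8 ^ t) * 8 ^ level u ∎)
      where open ≡-Reasoning
    above-u : ∃[ y ] level y ≡ suc (level u) × index y ≡ toℕ c * 8 ^ t
    above-u = parent-at u (≤-trans l<h (m≤m+n h h)) (toℕ c * 8 ^ t) (≤-reflexive (sym index-u))
    y : Vertex
    y = proj₁ above-u
    ly : level y ≡ suc (level u)
    ly = proj₁ (proj₂ above-u)
    iy : index y ≡ toℕ c * 8 ^ t
    iy = proj₂ (proj₂ above-u)
    ly+t : level y + t ≡ h
    ly+t = trans (cong (_+ t) ly) (trans (sym (+-suc (level u) t)) lu)
    py : position y ≡ toℕ c * 8 ^ h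
    py = trans (cong₂ (λ k l → k * 8 ^ l) iy ly)
      (trans (trans (regroup′ (toℕ c * 8 ^ t) (8 ^ level u)) (cong (_* 8 ^ level u) (sym index-u))) pu)

  col-connected : ∀ c {u v} → Col c u → Col c v → Star (InCol c) u v
  col-connected c {u} {v} (lu , pu) (lv , pv)
    with to-top c (h ∸ level u) (m+[n∸m]≡n lu) pu | to-top c (h ∸ level v) (m+[n∸m]≡n lv) pv
  ... | w , lw , iw , p | w′ , lw′ , iw′ , p′ with vertex-≡ {w} {w′} (trans lw (sym lw′)) (trans iw (sym iw′))
  ...   | refl = p ◅◅ Star.reverse (λ (e , a , b) → step-sym e , b , a) p′

  crossing : ∀ i c → ∃[ v ] Row i v × Col c v
  crossing i c = let v , lv , iv = vertex-at (toℕ i) (toℕ c * 8 ^ (h ∸ toℕ i)) (≤-trans i≤h (m≤m+n h h)) inside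
    in v , lv , subst (_≤ h) (sym lv) i≤h , trans (cong₂ (λ k l → k * 8 ^ l) iv lv) on-column
    where
    i≤h : toℕ i ≤ h
    i≤h = ≤-pred (Fin.toℕ<n i)
    on-column : toℕ c * 8 ^ (h ∸ toℕ i) * 8 ^ toℕ i ≡ toℕ c * 8 ^ h
    on-column = begin
      toℕ c * 8 ^ (h ∸ toℕ i) * 8 ^ toℕ i     ≡⟨ *-assoc (toℕ c) (8 ^ (h ∸ toℕ i)) (8 ^ toℕ i) ⟩
      toℕ c * (8 ^ (h ∸ toℕ i) * 8 ^ toℕ i)   ≡⟨ cong (toℕ c *_) (sym (^-distribˡ-+-* 8 (h ∸ toℕ i) (toℕ i))) ⟩
      toℕ c * 8 ^ (h ∸ toℕ i + toℕ i)         ≡⟨ cong (λ l → toℕ c * 8 ^ l) (m∸n+n≡m i≤h) ⟩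
      toℕ c * 8 ^ h ∎
      where open ≡-Reasoning
    inside : toℕ c * 8 ^ (h ∸ toℕ i) * 8 ^ toℕ i < 8 ^ (h + h)
    inside = begin-strict
      toℕ c * 8 ^ (h ∸ toℕ i) * 8 ^ toℕ i   ≡⟨ on-column ⟩
      toℕ c * 8 ^ h                         <⟨ *-monoˡ-< (8 ^ h) {{8^h-nonZero}} c<8^h ⟩
      8 ^ h * 8 ^ h                         ≡⟨ sym (^-distribˡ-+-* 8 h h) ⟩
      8 ^ (h + h) ∎
      where
      open ≤-Reasoning
      c<8^h : toℕ c < 8 ^ h
      c<8^h = ≤-<-trans (≤-pred (Fin.toℕ<n c)) (<-≤-trans (n<2^n h) (^-monoˡ-≤ h (m≤m+n 2 6)))

  treewidth-≥ : ∀ {w} → HasTreewidth graph w → h ≤ w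
  treewidth-≥ ((D , width) , _) = ≤-pred (Grid.bag-large graph Row Col
    (λ i v → level v ℕ.≟ toℕ i) (λ c v → level v ≤? h ×-dec position v ℕ.≟ toℕ c * 8 ^ h)
    (λ p q → Fin.toℕ-injective (trans (sym p) q))
    (λ {c} {c′} (_ , p) (_ , q) →
      Fin.toℕ-injective (*-cancelʳ-≡ (toℕ c) (toℕ c′) (8 ^ h) {{8^h-nonZero}} (trans (sym p) q)))
    (λ i → row-connected (toℕ i)) col-connected crossing D width)

-- Incomparability

record LargeTreewidth (C h : ℕ) : Set₁ where
  field
    G                         : WeightedGraph
    isMetric                  : IsMetric G
    treewidth-exists          : ¬ ¬ (∃[ w ] HasTreewidth (WeightedGraph.graph G) w)
    treewidth-≥               : ∀ {w} → HasTreewidth (WeightedGraph.graph G) w → h ≤ w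
    skeleton-dimension-exists : ¬ ¬ (∃[ k ] HasSkeletonDimension G k)
    skeleton-dimension-≤      : ∀ {k} → HasSkeletonDimension G k → k ≤ C

large-treewidth : ∀ h → LargeTreewidth (5 * window) h
large-treewidth h = record
  { G                         = weighted
  ; isMetric                  = isMetric
  ; treewidth-exists          = TrivialDecomposition.treewidth-exists graph root
  ; treewidth-≥               = SkipListGrid.treewidth-≥ h
  ; skeleton-dimension-exists = skeleton-dimension-exists (λ s path → CutSize.cut-size-≤ s path)
  ; skeleton-dimension-≤      = skeleton-dimension-≤ (λ s path → CutSize.cut-size-≤ s path)
  }
  where
  open SkipList (h + h)
  open PerturbedCuts graph connected base base-sym

-- A bound for `f` on all arguments up to a given one: `f` need not be monotone, and the skeleton
-- dimension is known only to be at most `C`.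
sum-up-to : (ℕ → ℕ) → ℕ → ℕ
sum-up-to f zero    = f 0
sum-up-to f (suc n) = f (suc n) + sum-up-to f n

≤-sum-up-to : ∀ f n {m} → m ≤ n → f m ≤ sum-up-to f n
≤-sum-up-to f zero    z≤n = ≤-refl
≤-sum-up-to f (suc n) m≤ with m≤n⇒m<n∨m≡n m≤
... | inj₁ (s≤s m≤n) = m≤n⇒m≤o+n (f (suc n)) (≤-sum-up-to f n m≤n)
... | inj₂ refl      = m≤m+n (f (suc n)) _

treewidth-unbounded : ∀ {C} → (∀ h → LargeTreewidth C h) →
  ¬ IsBoundedBy IsMetric (λ G → HasTreewidth (WeightedGraph.graph G)) HasSkeletonDimension
treewidth-unbounded {C} family (f , bound) =
  treewidth-exists λ (w , tw) → skeleton-dimension-exists λ (k , κ) →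
  1+n≰n (≤-trans (treewidth-≥ tw) (≤-trans (bound G isMetric w k tw κ) (≤-sum-up-to f C (skeleton-dimension-≤ κ))))
  where open LargeTreewidth (family (suc (sum-up-to f C)))

theorem20 : Incomparable IsMetric HasSkeletonDimension (λ G → HasTreewidth (WeightedGraph.graph G))
theorem20 = skeleton-dimension-unbounded , treewidth-unbounded large-treewidth
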